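{- Let $M,N$ be typable terms of the simply typed $\lambda$-calculus such that $M\to_\beta N$. Then $\mathcal T^{\mathbf m}(M)>\mathcal T^{\mathbf m}(N)$ in the (strict) multiset order.
   Context: Simple types: $A::=\alpha\mid A\to B$ with $\alpha$ ranging over base types. Terms of the simply typed $\lambda$-calculus (STLC, Church style, up to $\alpha$-renaming): $M::=x^A\mid\lambda x^A.M\mid M\,N$, with usual typing; $\to_\beta$ is the closure under contexts of $(\lambda x.M)\,N\to_\beta M[x:=N]$. $\lambda^{\mathbf m}$-terms: $t,s::=x^A\mid\lambda x^A.t\mid t\,s\mid t\{s\}$ (up to $\alpha$-renaming). Typing: the usual STLC rules plus: $\Gamma\vdash t:A$ and $\Gamma\vdash s:B$ imply $\Gamma\vdash t\{s\}:A$. "Term" means typable term; types are unique. Every $\lambda$-term is also a $\lambda^{\mathbf m}$-term. Memories: $L::=\Box\mid L\{t\}$; if $L=\Box\{s_1\}\dots\{s_n\}$, then $tL$ denotes $t\{s_1\}\dots\{s_n\}$. Reduction $\to_{\mathbf m}$ is the closure under arbitrary contexts of $(\lambda x.t)L\,s\to_{\mathbf m}t[x:=s]\{s\}L$ (with $x$ not free in $L$). An $\mathbf m$-abstraction is a term $(\lambda x.t)L$; its degree is the height of its type, where $\mathsf h(\alpha)=0$, $\mathsf h(A\to B)=1+\max(\mathsf h(A),\mathsf h(B))$. A redex is a term $(\lambda x.t)L\,s$; its degree is that of $(\lambda x.t)L$. $\mathsf{maxdeg}(t)$ is the maximum degree of the redexes in $t$, or $0$ if there are none. $t\xrightarrow{d}_{\mathbf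 m}s$ means $t\to_{\mathbf m}s$ by contracting a redex of degree $d$. A reduction $\rho:t\xrightarrow{d}{}^*_{\mathbf m}t'$ is a finite (possibly empty) sequence of composable steps of degree $d$, where each step records the redex occurrence contracted. For each $t$ and $d\ge1$ the set of all reductions of degree $d$ starting from $t$ is finite. Multisets: $[x_1,\dots,x_n]$ denotes a finite multiset, $+$ is multiset sum, $\mathbb M(X)$ is the set of finite multisets over $X$. For an ordered set $(X,>)$, $\mathfrak m+[x]\succ^1\mathfrak m+\mathfrak n$ if $x>y$ for every $y\in\mathfrak n$; the multiset order $\succ$ is the transitive closure of $\succ^1$. Codomains: $\mathbb T_d=\mathbb M(\{(i,b)\mid 1\le i\le d,\ b\in\mathbb R_i\})$ for $d\ge0$ and $\mathbb R_d=\mathbb M(\mathbb T_{d-1})$ for $d\ge1$, ordered by the multiset order, with pairs ordered lexicographically: $(i,b)>(i',b')$ iff $i>i'$ or ($i=i'$ and $b\succ b'$). If $d\le d'$ then $\mathbb T_d\subseteq\mathbb T_{d'}$, compatibly with the orders. Measures, defined by mutual recursion on the degree: $\mathcal T^{\mathbf m}_{\le D}(t)\in\mathbb T_D$ ($D\ge0$) is the multiset containing one element $(d,\mathcal R^{\mathbf m}_d(t))$ for each redex occurrence in $t$ of degree $d\le D$; $\mathcal R^{\mathbf m}_D(t)\in\mathbb R_D$ ($D\ge1$) is the multiset containing one element $\mathcal T^{\mathbf m}_{\le D-1}(t')$ for each reduction $\rho:t\xrightarrow{D}{}^*_{\mathbf m}t'$ (with $t'$ arbitrary). For a typable $\lambda$-term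 $M$, $\mathcal T^{\mathbf m}(M)=\mathcal T^{\mathbf m}_{\le D}(M)$ with $D=\mathsf{maxdeg}(M)$. -}

module Defs where

open import Data.Empty using (⊥-elim)
open import Data.List.Base using (List; []; _∷_; _++_; map; concatMap; mapMaybe; foldr)
open import Data.List.Membership.Propositional using (_∈_)
open import Data.List.Membership.Propositional.Properties using (∈-map⁺; ∈-map⁻; ∈-++⁺ˡ; ∈-++⁺ʳ; ∈-++⁻)
open import Data.List.Properties using (map-cong; mapMaybe-cong)
open import Data.List.Relation.Binary.Permutation.Homogeneous using (Permutation)
open import Data.List.Relation.Unary.All as All using (All; []; _∷_)
open import Data.List.Relation.Unary.AllPairs using ([]; _∷_)
open import Data.List.Relation.Unary.Any using (here; there)
open import Data.List.Relation.Unary.Unique.Propositional using (Unique)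
open import Data.List.Relation.Unary.Unique.Propositional.Properties using (map⁺; ++⁺)
open import Data.Maybe.Base using (Maybe; just; nothing)
open import Data.Nat.Base using (ℕ; zero; suc; pred; _+_; _⊔_; _≤_; _<_; _>_; z≤n; s≤s)
open import Data.Nat.Induction using (<-wellFounded)
open import Data.Nat.Properties using (_≟_; _≤?_; ≡-irrelevant; ≤-refl; ≤-reflexive; ≤-trans; ≤-antisym; <⇒≢; <⇒≤; +-mono-≤; +-mono-<-≤; +-mono-≤-<; +-assoc; +-comm; m≤m⊔n; m≤n⊔m; module ≤-Reasoning)
open import Data.Product.Base using (Σ; ∃; _×_; _,_; proj₁; proj₂)
open import Data.Sum.Base using (_⊎_; inj₁; inj₂)
open import Data.Unit.Base using (⊤; tt)
open import Function.Base using (_∘_)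
open import Induction.WellFounded using (Acc; acc)
open import Level using (0ℓ)
open import Relation.Binary.Construct.Closure.Transitive using (TransClosure)
open import Relation.Binary.Core using (Rel)
open import Relation.Binary.PropositionalEquality using (_≡_; refl; sym; trans; cong; cong₂; subst)
open import Relation.Nullary using (¬_; Dec; yes; no)

infixr 7 _⇒_
infixl 5 _▸_
infix  4 _∋_

data Ty (Base : Set) : Set where
  base : Base → Ty Base
  _⇒_  : Ty Base → Ty Base → Ty Base

data Ctx (Base : Set) : Set where
  ∅   : Ctx Base
  _▸_ : Ctx Base → Ty Base → Ctx Base

private
  variable
    Base  : Set
    Γ Δ Θ : Ctx Base
    A B C : Ty Base

data _∋_ {Base : Set} : Ctx Base → Ty Base → Set where
  z : Γ ▸ A ∋ A
  s : Γ ∋ A → Γ ▸ B ∋ A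

height : Ty Base → ℕ
height (base α) = 0
height (A ⇒ B)  = suc (height A ⊔ height B)

-- Λ: the simply typed λ-calculus.  Terms are intrinsically typed de Bruijn
-- terms, i.e. typable Church-style terms up to α-renaming.
infixl 8 _·_
infix  9 _[_]

data Λ {Base : Set} (Γ : Ctx Base) : Ty Base → Set where
  var : Γ ∋ A → Λ Γ A
  ƛ_  : Λ (Γ ▸ A) B → Λ Γ (A ⇒ B)
  _·_ : Λ Γ (A ⇒ B) → Λ Γ A → Λ Γ B

Ren : {Base : Set} → Ctx Base → Ctx Base → Set
Ren {Base} Γ Δ = ∀ {A : Ty Base} → Γ ∋ A → Δ ∋ A

extᴿ : Ren Γ Δ → Ren (Γ ▸ A) (Δ ▸ A)
extᴿ ξ z     = z
extᴿ ξ (s x) = s (ξ x)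

module β where

  Sub : {Base : Set} → Ctx Base → Ctx Base → Set
  Sub {Base} Γ Δ = ∀ {A : Ty Base} → Γ ∋ A → Λ Δ A

  rename : Ren Γ Δ → Λ Γ A → Λ Δ A
  rename ξ (var x) = var (ξ x)
  rename ξ (ƛ M)   = ƛ rename (extᴿ ξ) M
  rename ξ (M · N) = rename ξ M · rename ξ N

  exts : Sub Γ Δ → Sub (Γ ▸ A) (Δ ▸ A)
  exts σ z     = var z
  exts σ (s x) = rename s (σ x)

  substitute : Sub Γ Δ → Λ Γ A → Λ Δ A
  substitute σ (var x) = σ x
  substitute σ (ƛ M)   = ƛ substitute (exts σ) M
  substitute σ (M · N) = substitute σ M · substitute σ N

  single : Λ Γ A → Sub (Γ ▸ A) Γ
  single N z     = N
  single N (s x) = var x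

  _[_] : Λ (Γ ▸ A) B → Λ Γ A → Λ Γ B
  M [ N ] = substitute (single N) M

infix 3 _⟶β_

data _⟶β_ {Base : Set} {Γ : Ctx Base} : {A : Ty Base} → Λ Γ A → Λ Γ A → Set where
  β   : {M : Λ (Γ ▸ A) B} {N : Λ Γ A} → (ƛ M) · N ⟶β M β.[ N ]
  ξ-ƛ : {M M′ : Λ (Γ ▸ A) B} → M ⟶β M′ → ƛ M ⟶β ƛ M′
  ξ-l : {M M′ : Λ Γ (A ⇒ B)} {N : Λ Γ A} → M ⟶β M′ → M · N ⟶β M′ · N
  ξ-r : {M : Λ Γ (A ⇒ B)} {N N′ : Λ Γ A} → N ⟶β N′ → M · N ⟶β M · N′

infix  4 _⊢_
infixl 8 _❴_❵ _⟨_⟩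

data _⊢_ {Base : Set} (Γ : Ctx Base) : Ty Base → Set where
  var   : Γ ∋ A → Γ ⊢ A
  ƛ_    : Γ ▸ A ⊢ B → Γ ⊢ A ⇒ B
  _·_   : Γ ⊢ A ⇒ B → Γ ⊢ A → Γ ⊢ B
  _❴_❵  : Γ ⊢ A → Γ ⊢ B → Γ ⊢ A

⌈_⌉ : Λ Γ A → Γ ⊢ A
⌈ var x ⌉ = var x
⌈ ƛ M ⌉   = ƛ ⌈ M ⌉
⌈ M · N ⌉ = ⌈ M ⌉ · ⌈ N ⌉

Sub : {Base : Set} → Ctx Base → Ctx Base → Set
Sub {Base} Γ Δ = ∀ {A : Ty Base} → Γ ∋ A → Δ ⊢ A

rename : Ren Γ Δ → Γ ⊢ A → Δ ⊢ A
rename ξ (var x)     = var (ξ x)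
rename ξ (ƛ t)       = ƛ rename (extᴿ ξ) t
rename ξ (t · u)     = rename ξ t · rename ξ u
rename ξ (t ❴ u ❵)   = rename ξ t ❴ rename ξ u ❵

exts : Sub Γ Δ → Sub (Γ ▸ A) (Δ ▸ A)
exts σ z     = var z
exts σ (s x) = rename s (σ x)

substitute : Sub Γ Δ → Γ ⊢ A → Δ ⊢ A
substitute σ (var x)   = σ x
substitute σ (ƛ t)     = ƛ substitute (exts σ) t
substitute σ (t · u)   = substitute σ t · substitute σ u
substitute σ (t ❴ u ❵) = substitute σ t ❴ substitute σ u ❵

single : Γ ⊢ A → Sub (Γ ▸ A) Γ
single u z     = u
single u (s x) = var x

_[_] : Γ ▸ A ⊢ B → Γ ⊢ A → Γ ⊢ B
t [ u ] = substitute (single u) t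

data Memory {Base : Set} (Γ : Ctx Base) : Set where
  □    : Memory Γ
  _❴_❵ : Memory Γ → Γ ⊢ A → Memory Γ

_⟨_⟩ : Γ ⊢ A → Memory Γ → Γ ⊢ A
t ⟨ □ ⟩       = t
t ⟨ L ❴ u ❵ ⟩ = t ⟨ L ⟩ ❴ u ❵

-- MAbs u holds, in a unique way, iff u has the form (ƛ t) ⟨ L ⟩; see
-- MAbs-decompose, MAbs-intro and MAbs-irrelevant.
data MAbs {Base : Set} {Γ : Ctx Base} {A B : Ty Base} : Γ ⊢ A ⇒ B → Set where
  lam : (t : Γ ▸ A ⊢ B) → MAbs (ƛ t)
  mem : {u : Γ ⊢ A ⇒ B} → MAbs u → (r : Γ ⊢ C) → MAbs (u ❴ r ❵)

body : {u : Γ ⊢ A ⇒ B} → MAbs u → Γ ▸ A ⊢ B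
body (lam t)   = t
body (mem m r) = body m

memory : {u : Γ ⊢ A ⇒ B} → MAbs u → Memory Γ
memory (lam t)   = □
memory (mem m r) = memory m ❴ r ❵

MAbs-decompose : {u : Γ ⊢ A ⇒ B} (m : MAbs u) → u ≡ (ƛ body m) ⟨ memory m ⟩
MAbs-decompose (lam t)   = refl
MAbs-decompose (mem m r) = cong (_❴ r ❵) (MAbs-decompose m)

MAbs-intro : (t : Γ ▸ A ⊢ B) (L : Memory Γ) → MAbs ((ƛ t) ⟨ L ⟩)
MAbs-intro t □         = lam t
MAbs-intro t (L ❴ r ❵) = mem (MAbs-intro t L) r

MAbs-irrelevant : {u : Γ ⊢ A ⇒ B} (m n : MAbs u) → m ≡ n
MAbs-irrelevant (lam t)   (lam .t)   = refl
MAbs-irrelevant (mem m r) (mem n .r) = cong (λ k → mem k r) (MAbs-irrelevant m n)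

MAbs? : (u : Γ ⊢ A ⇒ B) → Dec (MAbs u)
MAbs? (var x) = no λ ()
MAbs? (ƛ t)   = yes (lam t)
MAbs? (t · u) = no λ ()
MAbs? (t ❴ r ❵) with MAbs? t
... | yes m = yes (mem m r)
... | no ¬m = no λ { (mem m .r) → ¬m m }

data Redex {Base : Set} {Γ : Ctx Base} : {A : Ty Base} → Γ ⊢ A → Set where
  root  : {u : Γ ⊢ A ⇒ B} {v : Γ ⊢ A} → MAbs u → Redex (u · v)
  in-ƛ  : {t : Γ ▸ A ⊢ B} → Redex t → Redex (ƛ t)
  app-l : {u : Γ ⊢ A ⇒ B} {v : Γ ⊢ A} → Redex u → Redex (u · v)
  app-r : {u : Γ ⊢ A ⇒ B} {v : Γ ⊢ A} → Redex v → Redex (u · v)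
  mem-l : {t : Γ ⊢ A} {r : Γ ⊢ B} → Redex t → Redex (t ❴ r ❵)
  mem-r : {t : Γ ⊢ A} {r : Γ ⊢ B} → Redex r → Redex (t ❴ r ❵)

degree : {t : Γ ⊢ A} → Redex t → ℕ
degree (root {A = A} {B = B} m) = height (A ⇒ B)
degree (in-ƛ r)  = degree r
degree (app-l r) = degree r
degree (app-r r) = degree r
degree (mem-l r) = degree r
degree (mem-r r) = degree r

contract : {t : Γ ⊢ A} → Redex t → Γ ⊢ A
contract (root {v = v} m)      = (body m [ v ] ❴ v ❵) ⟨ memory m ⟩
contract (in-ƛ r)              = ƛ contract r
contract (app-l {v = v} r)     = contract r · v
contract (app-r {u = u} r)     = u · contract r
contract (mem-l {r = r′} r)    = contract r ❴ r′ ❵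
contract (mem-r {t = t} r)     = t ❴ contract r ❵

degree≥1 : {t : Γ ⊢ A} (r : Redex t) → 1 ≤ degree r
degree≥1 (root m)  = s≤s z≤n
degree≥1 (in-ƛ r)  = degree≥1 r
degree≥1 (app-l r) = degree≥1 r
degree≥1 (app-r r) = degree≥1 r
degree≥1 (mem-l r) = degree≥1 r
degree≥1 (mem-r r) = degree≥1 r

data Reduction {Base : Set} {Γ : Ctx Base} {A : Ty Base} (d : ℕ) : Γ ⊢ A → Γ ⊢ A → Set where
  done : {t : Γ ⊢ A} → Reduction d t t
  step : {t t′ : Γ ⊢ A} (r : Redex t) → degree r ≡ d → Reduction d (contract r) t′ → Reduction d t t′

ReductionFrom : ℕ → Γ ⊢ A → Set
ReductionFrom d t = ∃ λ t′ → Reduction d t t′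

-- Finiteness of X: a list containing every element exactly once.
record Enumeration (X : Set) : Set where
  field
    elements : List X
    complete : (x : X) → x ∈ elements
    unique   : Unique elements

open Enumeration public

private
  enum-map : {X Y : Set} (f : X → Y) → (∀ {x y} → f x ≡ f y → x ≡ y) →
             (∀ y → ∃ λ x → f x ≡ y) → Enumeration X → Enumeration Y
  enum-map f inj sur e = record
    { elements = map f (elements e)
    ; complete = λ y → subst (_∈ map f (elements e)) (proj₂ (sur y)) (∈-map⁺ f (complete e (proj₁ (sur y))))
    ; unique   = map⁺ inj (unique e)
    }

  enum-⊤ : Enumeration ⊤
  enum-⊤ = record { elements = tt ∷ [] ; complete = λ _ → here refl ; unique = [] ∷ [] }

  enum-dec : {X : Set} → Dec X → (∀ (x y : X) → x ≡ y) → Enumeration X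
  enum-dec (yes x) irr = record { elements = x ∷ [] ; complete = λ y → here (irr y x) ; unique = [] ∷ [] }
  enum-dec (no ¬x) irr = record { elements = [] ; complete = λ y → ⊥-elim (¬x y) ; unique = [] }

  enum-⊎ : {X Y : Set} → Enumeration X → Enumeration Y → Enumeration (X ⊎ Y)
  enum-⊎ {X} {Y} e f = record
    { elements = map inj₁ (elements e) ++ map inj₂ (elements f)
    ; complete = λ { (inj₁ x) → ∈-++⁺ˡ (∈-map⁺ inj₁ (complete e x))
                   ; (inj₂ y) → ∈-++⁺ʳ (map inj₁ (elements e)) (∈-map⁺ inj₂ (complete f y)) }
    ; unique   = ++⁺ (map⁺ (λ { refl → refl }) (unique e)) (map⁺ (λ { refl → refl }) (unique f)) disjoint
    }
    where
    disjoint : ∀ {v} → ¬ (v ∈ map inj₁ (elements e) × v ∈ map inj₂ (elements f))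
    disjoint (p , q) with ∈-map⁻ inj₁ p | ∈-map⁻ inj₂ q
    ... | _ , _ , refl | _ , _ , ()

  module _ {X : Set} {Y : X → Set} (f : ∀ x → Enumeration (Y x)) where

    pairs : List X → List (Σ X Y)
    pairs = concatMap (λ x → map (x ,_) (elements (f x)))

    pairs-complete : ∀ {xs x} (y : Y x) → x ∈ xs → (x , y) ∈ pairs xs
    pairs-complete {x = x} y (here refl) = ∈-++⁺ˡ (∈-map⁺ (x ,_) (complete (f x) y))
    pairs-complete {x′ ∷ xs} y (there p) = ∈-++⁺ʳ (map (x′ ,_) (elements (f x′))) (pairs-complete y p)

    pairs-∈ : ∀ xs {p} → p ∈ pairs xs → proj₁ p ∈ xs
    pairs-∈ (x ∷ xs) q with ∈-++⁻ (map (x ,_) (elements (f x))) q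
    ... | inj₂ q′ = there (pairs-∈ xs q′)
    ... | inj₁ q′ with ∈-map⁻ (x ,_) q′
    ... | _ , _ , refl = here refl

    pairs-unique : ∀ {xs} → Unique xs → Unique (pairs xs)
    pairs-unique [] = []
    pairs-unique {x ∷ xs} (x∉ ∷ u) = ++⁺ (map⁺ (λ { refl → refl }) (unique (f x))) (pairs-unique u) disjoint
      where
      disjoint : ∀ {v} → ¬ (v ∈ map (x ,_) (elements (f x)) × v ∈ pairs xs)
      disjoint (p , q) with ∈-map⁻ (x ,_) p
      ... | _ , _ , refl = All.lookup x∉ (pairs-∈ xs q) refl

    enum-Σ : Enumeration X → Enumeration (Σ X Y)
    enum-Σ e = record
      { elements = pairs (elements e)
      ; complete = λ { (x , y) → pairs-complete y (complete e x) }
      ; unique   = pairs-unique (unique e)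
      }

redex-enumeration : (t : Γ ⊢ A) → Enumeration (Redex t)
redex-enumeration (var x) = record { elements = [] ; complete = λ () ; unique = [] }
redex-enumeration (ƛ t) =
  enum-map in-ƛ (λ { refl → refl }) (λ { (in-ƛ r) → r , refl }) (redex-enumeration t)
redex-enumeration (u · v) =
  enum-map {X = MAbs u ⊎ Redex u ⊎ Redex v}
    (λ { (inj₁ m) → root m ; (inj₂ (inj₁ r)) → app-l r ; (inj₂ (inj₂ r)) → app-r r })
    (λ { {inj₁ _} {inj₁ _} refl → refl
       ; {inj₂ (inj₁ _)} {inj₂ (inj₁ _)} refl → refl
       ; {inj₂ (inj₂ _)} {inj₂ (inj₂ _)} refl → refl
       ; {inj₁ _} {inj₂ (inj₁ _)} () ; {inj₁ _} {inj₂ (inj₂ _)} ()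
       ; {inj₂ (inj₁ _)} {inj₁ _} () ; {inj₂ (inj₂ _)} {inj₁ _} ()
       ; {inj₂ (inj₁ _)} {inj₂ (inj₂ _)} () ; {inj₂ (inj₂ _)} {inj₂ (inj₁ _)} () })
    (λ { (root m) → inj₁ m , refl ; (app-l r) → inj₂ (inj₁ r) , refl ; (app-r r) → inj₂ (inj₂ r) , refl })
    (enum-⊎ (enum-dec (MAbs? u) MAbs-irrelevant) (enum-⊎ (redex-enumeration u) (redex-enumeration v)))
redex-enumeration (t ❴ u ❵) =
  enum-map {X = Redex t ⊎ Redex u}
    (λ { (inj₁ r) → mem-l r ; (inj₂ r) → mem-r r })
    (λ { {inj₁ _} {inj₁ _} refl → refl ; {inj₂ _} {inj₂ _} refl → refl
       ; {inj₁ _} {inj₂ _} () ; {inj₂ _} {inj₁ _} () })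
    (λ { (mem-l r) → inj₁ r , refl ; (mem-r r) → inj₂ r , refl })
    (enum-⊎ (redex-enumeration t) (redex-enumeration u))

redexes : (t : Γ ⊢ A) → List (Redex t)
redexes t = elements (redex-enumeration t)

maxdeg : Γ ⊢ A → ℕ
maxdeg t = foldr _⊔_ 0 (map degree (redexes t))

-- Reductions of a fixed degree d are finite in number.  Contracting a redex
-- of degree d only creates redexes of smaller degree, so such reductions are
-- developments; weight d decreases along each of their steps.

Env : {Base : Set} → Ctx Base → Set
Env {Base} Γ = {A : Ty Base} → Γ ∋ A → ℕ

_,,_ : Env Γ → ℕ → Env (Γ ▸ A)
(ρ ,, n) z     = n
(ρ ,, n) (s x) = ρ x

module Development (d : ℕ) where

  arg : ℕ → ℕ → Maybe ℕ
  arg h n with h ≟ d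
  ... | yes _ = just n
  ... | no  _ = nothing

  -- The last argument is  just n  if the term stands in function position at
  -- degree d, applied to an argument of weight n.
  weight : Γ ⊢ A → Env Γ → Maybe ℕ → ℕ
  weight (var x)                   ρ m        = ρ x
  weight (ƛ t)                     ρ nothing  = weight t (ρ ,, 0) nothing
  weight (ƛ t)                     ρ (just n) = suc (weight t (ρ ,, n) nothing)
  weight (_·_ {A = A} {B = B} t u) ρ m        =
    weight t ρ (arg (height (A ⇒ B)) (weight u ρ nothing)) + weight u ρ nothing
  weight (t ❴ u ❵)                 ρ m        = weight t ρ m + weight u ρ nothing

  data _⊑_ : Maybe ℕ → Maybe ℕ → Set where
    nothing : nothing ⊑ nothing
    just    : ∀ {m n} → m ≤ n → just m ⊑ just n

  ⊑-refl : ∀ {m} → m ⊑ m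
  ⊑-refl {nothing} = nothing
  ⊑-refl {just _}  = just ≤-refl

  arg-mono : ∀ h {m n} → m ≤ n → arg h m ⊑ arg h n
  arg-mono h p with h ≟ d
  ... | yes _ = just p
  ... | no  _ = nothing

  ,,-mono : {ρ ρ′ : Env Γ} {m n : ℕ} → (∀ {B} (x : Γ ∋ B) → ρ x ≤ ρ′ x) → m ≤ n →
            ∀ {B} (x : Γ ▸ A ∋ B) → (ρ ,, m) x ≤ (ρ′ ,, n) x
  ,,-mono p q z     = q
  ,,-mono p q (s x) = p x

  weight-mono : (t : Γ ⊢ A) {ρ ρ′ : Env Γ} {m n : Maybe ℕ} →
                (∀ {B} (x : Γ ∋ B) → ρ x ≤ ρ′ x) → m ⊑ n → weight t ρ m ≤ weight t ρ′ n
  weight-mono (var x)   p q        = p x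
  weight-mono (ƛ t) {ρ} {ρ′} p nothing  = weight-mono t (,,-mono {ρ = ρ} {ρ′} p z≤n) nothing
  weight-mono (ƛ t) {ρ} {ρ′} p (just q) = s≤s (weight-mono t (,,-mono {ρ = ρ} {ρ′} p q) nothing)
  weight-mono (_·_ {A = A} {B = B} t u) {ρ} {ρ′} p q =
    +-mono-≤ (weight-mono t p (arg-mono (height (A ⇒ B)) (weight-mono u {ρ} {ρ′} p nothing))) (weight-mono u p nothing)
  weight-mono (t ❴ u ❵) p q        = +-mono-≤ (weight-mono t p q) (weight-mono u p nothing)

  weight-cong : (t : Γ ⊢ A) {ρ ρ′ : Env Γ} {m : Maybe ℕ} →
                (∀ {B} (x : Γ ∋ B) → ρ x ≡ ρ′ x) → weight t ρ m ≡ weight t ρ′ m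
  weight-cong t p = ≤-antisym (weight-mono t (λ x → ≤-reflexive (p x)) ⊑-refl)
                              (weight-mono t (λ x → ≤-reflexive (sym (p x))) ⊑-refl)

  weight-rename : (ξ : Ren Γ Δ) (t : Γ ⊢ A) (ρ : Env Δ) (m : Maybe ℕ) →
                  weight (rename ξ t) ρ m ≡ weight t (λ x → ρ (ξ x)) m
  weight-rename-ƛ : (ξ : Ren Γ Δ) (t : Γ ▸ C ⊢ A) (ρ : Env Δ) (n : ℕ) →
                    weight (rename (extᴿ ξ) t) (ρ ,, n) nothing ≡ weight t ((λ x → ρ (ξ x)) ,, n) nothing

  weight-rename ξ (var x) ρ m          = refl
  weight-rename ξ (ƛ t) ρ nothing      = weight-rename-ƛ ξ t ρ 0
  weight-rename ξ (ƛ t) ρ (just n)     = cong suc (weight-rename-ƛ ξ t ρ n)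
  weight-rename ξ (t · u) ρ m rewrite weight-rename ξ u ρ nothing = cong (_+ _) (weight-rename ξ t ρ _)
  weight-rename ξ (t ❴ u ❵) ρ m        = cong₂ _+_ (weight-rename ξ t ρ m) (weight-rename ξ u ρ nothing)

  weight-rename-ƛ ξ t ρ n = trans (weight-rename (extᴿ ξ) t (ρ ,, n) nothing)
                                  (weight-cong t (λ { z → refl ; (s x) → refl }))

  Fits : Ty Base → Maybe ℕ → Set
  Fits A m = m ≡ nothing ⊎ height A ≡ d

  arg-fits : ∀ (A : Ty Base) n → Fits A (arg (height A) n)
  arg-fits A n with height A ≟ d
  ... | yes p = inj₂ p
  ... | no  _ = inj₁ refl

  -- σ creates no redexes of degree d.
  Inert : {Base : Set} {Γ Δ : Ctx Base} → Sub Γ Δ → Set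
  Inert {Base} {Γ} {Δ} σ = ∀ {A : Ty Base} (x : Γ ∋ A) → height A ≡ d → (ρ : Env Δ) (m : Maybe ℕ) →
                           weight (σ x) ρ m ≡ weight (σ x) ρ nothing

  exts-inert : (σ : Sub Γ Δ) → Inert σ → Inert (exts {A = C} σ)
  exts-inert σ i z     e ρ m = refl
  exts-inert σ i (s x) e ρ m = trans (weight-rename s (σ x) ρ m)
                              (trans (i x e (λ y → ρ (s y)) m) (sym (weight-rename s (σ x) ρ nothing)))

  weight-sub : (σ : Sub Γ Δ) → Inert σ → (t : Γ ⊢ A) (ρ : Env Δ) (m : Maybe ℕ) → Fits A m →
               weight (substitute σ t) ρ m ≡ weight t (λ x → weight (σ x) ρ nothing) m
  weight-sub-ƛ : (σ : Sub Γ Δ) → Inert σ → (t : Γ ▸ C ⊢ A) (ρ : Env Δ) (n : ℕ) →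
                 weight (substitute (exts σ) t) (ρ ,, n) nothing ≡
                 weight t ((λ x → weight (σ x) ρ nothing) ,, n) nothing

  weight-sub σ i (var x) ρ m (inj₁ refl)  = refl
  weight-sub σ i (var x) ρ m (inj₂ e)     = i x e ρ m
  weight-sub σ i (ƛ t) ρ nothing f        = weight-sub-ƛ σ i t ρ 0
  weight-sub σ i (ƛ t) ρ (just n) f       = cong suc (weight-sub-ƛ σ i t ρ n)
  weight-sub σ i (_·_ {A = A} {B = B} t u) ρ m f
    rewrite weight-sub σ i u ρ nothing (inj₁ refl) =
    cong (_+ _) (weight-sub σ i t ρ _ (arg-fits (A ⇒ B) _))
  weight-sub σ i (t ❴ u ❵) ρ m f          = cong₂ _+_ (weight-sub σ i t ρ m f) (weight-sub σ i u ρ nothing (inj₁ refl))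

  weight-sub-ƛ σ i t ρ n =
    trans (weight-sub (exts σ) (exts-inert σ i) t (ρ ,, n) nothing (inj₁ refl))
          (weight-cong t (λ { z → refl ; (s x) → weight-rename s (σ x) (ρ ,, n) nothing }))

  single-inert : (u : Γ ⊢ A) → height A < d → Inert (single u)
  single-inert u h<d z     e ρ m = ⊥-elim (<⇒≢ h<d e)
  single-inert u h<d (s x) e ρ m = refl

  root-decreases : {u : Γ ⊢ A ⇒ B} (k : MAbs u) (v : Γ ⊢ A) → height A < d → (ρ : Env Γ) →
                   weight ((body k [ v ] ❴ v ❵) ⟨ memory k ⟩) ρ nothing <
                   weight u ρ (just (weight v ρ nothing)) + weight v ρ nothing
  root-decreases (lam t) v h<d ρ = s≤s (≤-reflexive (cong (_+ weight v ρ nothing)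
    (trans (weight-sub (single v) (single-inert v h<d) t ρ nothing (inj₁ refl))
           (weight-cong t (λ { z → refl ; (s x) → refl })))))
  root-decreases (mem {u = u} k r) v h<d ρ = begin-strict
      weight ((body k [ v ] ❴ v ❵) ⟨ memory k ⟩) ρ nothing + R  <⟨ +-mono-<-≤ (root-decreases k v h<d ρ) ≤-refl ⟩
      (U + V) + R                                               ≡⟨ +-assoc U V R ⟩
      U + (V + R)                                               ≡⟨ cong (U +_) (+-comm V R) ⟩
      U + (R + V)                                               ≡⟨ sym (+-assoc U R V) ⟩
      (U + R) + V                                               ∎
    where
    open ≤-Reasoning
    V = weight v ρ nothing
    U = weight u ρ (just V)
    R = weight r ρ nothing

  weight-decreases : {t : Γ ⊢ A} (r : Redex t) → degree r ≡ d → (ρ : Env Γ) (m : Maybe ℕ) → Fits A m →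
                     weight (contract r) ρ m < weight t ρ m
  weight-decreases (root {A = A} {B = B} {v = v} k) e ρ m f
    with height (A ⇒ B) ≟ d | f
  ... | no ¬e | _         = ⊥-elim (¬e e)
  ... | yes _ | inj₁ refl = root-decreases k v (≤-trans (s≤s (m≤m⊔n _ _)) (≤-reflexive e)) ρ
  ... | yes _ | inj₂ e′   = ⊥-elim (<⇒≢ (≤-trans (s≤s (m≤n⊔m (height A) (height B))) (≤-reflexive e)) e′)
  weight-decreases (in-ƛ r) e ρ nothing f  = weight-decreases r e (ρ ,, 0) nothing (inj₁ refl)
  weight-decreases (in-ƛ r) e ρ (just n) f = s≤s (weight-decreases r e (ρ ,, n) nothing (inj₁ refl))
  weight-decreases (app-l {A = A} {B = B} r) e ρ m f =
    +-mono-<-≤ (weight-decreases r e ρ _ (arg-fits (A ⇒ B) _)) ≤-refl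
  weight-decreases (app-r {A = A} {B = B} {u = u} r) e ρ m f =
    +-mono-≤-< (weight-mono u (λ _ → ≤-refl) (arg-mono (height (A ⇒ B)) (<⇒≤ v′<v))) v′<v
    where v′<v = weight-decreases r e ρ nothing (inj₁ refl)
  weight-decreases (mem-l r) e ρ m f       = +-mono-<-≤ (weight-decreases r e ρ m f) ≤-refl
  weight-decreases (mem-r {t = t} r) e ρ m f =
    +-mono-≤-< (≤-refl {weight t ρ m}) (weight-decreases r e ρ nothing (inj₁ refl))

  size : Γ ⊢ A → ℕ
  size t = weight t (λ _ → 0) nothing

  Unrolled : Γ ⊢ A → Set
  Unrolled t = ⊤ ⊎ Σ (Redex t) λ r → Σ (degree r ≡ d) λ _ → ReductionFrom d (contract r)

  roll : {t : Γ ⊢ A} → Unrolled t → ReductionFrom d t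
  roll (inj₁ tt)                = _ , done
  roll (inj₂ (r , e , t′ , ρ))  = t′ , step r e ρ

  roll-injective : {t : Γ ⊢ A} {x y : Unrolled t} → roll x ≡ roll y → x ≡ y
  roll-injective {x = inj₁ tt} {inj₁ tt} refl = refl
  roll-injective {x = inj₂ _}  {inj₂ _}  refl = refl
  roll-injective {x = inj₁ tt} {inj₂ _}  ()
  roll-injective {x = inj₂ _}  {inj₁ tt} ()

  roll-surjective : {t : Γ ⊢ A} (y : ReductionFrom d t) → ∃ λ x → roll x ≡ y
  roll-surjective (_ , done)        = inj₁ tt , refl
  roll-surjective (t′ , step r e ρ) = inj₂ (r , e , t′ , ρ) , refl

  enumerate : (t : Γ ⊢ A) → Acc _<_ (size t) → Enumeration (ReductionFrom d t)
  enumerate t (acc rs) = enum-map roll roll-injective roll-surjective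
    (enum-⊎ enum-⊤
      (enum-Σ (λ r → enum-Σ (λ e → enumerate (contract r) (rs (weight-decreases r e (λ _ → 0) nothing (inj₁ refl))))
                            (enum-dec (degree r ≟ d) ≡-irrelevant))
              (redex-enumeration t)))

reduction-enumeration : (d : ℕ) (t : Γ ⊢ A) → Enumeration (ReductionFrom d t)
reduction-enumeration d t = Development.enumerate d t (<-wellFounded _)

reductions : (d : ℕ) (t : Γ ⊢ A) → List (ReductionFrom d t)
reductions d t = elements (reduction-enumeration d t)

-- Multisets are lists, compared up to permutation and up to the equality of
-- their elements.  The step is  ms + [x]  ≻¹  ms + ns.
data MultisetStep {X : Set} (_≈_ _>_ : Rel X 0ℓ) (xs ys : List X) : Set where
  replace : (ms : List X) (x : X) (ns : List X) →
            Permutation _≈_ xs (ms ++ x ∷ []) → Permutation _≈_ ys (ms ++ ns) →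
            All (x >_) ns → MultisetStep _≈_ _>_ xs ys

MultisetOrder : {X : Set} (_≈_ _>_ : Rel X 0ℓ) → Rel (List X) 0ℓ
MultisetOrder _≈_ _>_ = TransClosure (MultisetStep _≈_ _>_)

-- Entry d is the set of pairs (i , b) with 1 ≤ i ≤ d and b ∈ ℝ i.
data Entry (d : ℕ) : Set where
  entry : (i : ℕ) → 1 ≤ i → i ≤ d → List (List (Entry (pred i))) → Entry d

𝕋 : ℕ → Set
𝕋 d = List (Entry d)

-- Used only for d ≥ 1.
ℝ : ℕ → Set
ℝ d = List (𝕋 (pred d))

data _≈ᴱ_ {d : ℕ} : Rel (Entry d) 0ℓ where
  entry : ∀ {i p q p′ q′ b b′} → Permutation (Permutation _≈ᴱ_) b b′ → entry i p q b ≈ᴱ entry i p′ q′ b′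

_≈ᵀ_ : {d : ℕ} → Rel (𝕋 d) 0ℓ
_≈ᵀ_ = Permutation _≈ᴱ_

data _>ᴱ_ {d : ℕ} : Rel (Entry d) 0ℓ where
  left  : ∀ {i i′ p q p′ q′ b b′} → i > i′ → entry i p q b >ᴱ entry i′ p′ q′ b′
  right : ∀ {i p q p′ q′ b b′} → MultisetOrder _≈ᵀ_ (MultisetOrder _≈ᴱ_ _>ᴱ_) b b′ →
          entry i p q b >ᴱ entry i p′ q′ b′

_≻ᵀ_ : {d : ℕ} → Rel (𝕋 d) 0ℓ
_≻ᵀ_ = MultisetOrder _≈ᴱ_ _>ᴱ_

-- The inclusion 𝕋 d ⊆ 𝕋 d′ for d ≤ d′.
include : {d d′ : ℕ} → d ≤ d′ → 𝕋 d → 𝕋 d′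
include d≤d′ = map λ { (entry i p q b) → entry i p (≤-trans q d≤d′) b }

-- The order on the union of all the 𝕋 d.
_≻_ : {d d′ : ℕ} → 𝕋 d → 𝕋 d′ → Set
_≻_ {d} {d′} x y = include (m≤m⊔n d d′) x ≻ᵀ include (m≤n⊔m d d′) y

private
  pred< : ∀ {i D} → 1 ≤ i → i ≤ D → pred i < D
  pred< (s≤s _) i≤D = i≤D

  mutual
    𝒯ᴬ : (D : ℕ) → Acc _<_ D → Γ ⊢ A → 𝕋 D
    𝒯ᴬ D a t = mapMaybe (𝒯ᴬ-entry D a t) (redexes t)

    𝒯ᴬ-entry : (D : ℕ) → Acc _<_ D → (t : Γ ⊢ A) → Redex t → Maybe (Entry D)
    𝒯ᴬ-entry D (acc rs) t r with degree r ≤? D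
    ... | yes d≤D = just (entry (degree r) (degree≥1 r) d≤D (ℛᴬ (degree r) (rs (pred< (degree≥1 r) d≤D)) t))
    ... | no _    = nothing

    ℛᴬ : (D : ℕ) → Acc _<_ (pred D) → Γ ⊢ A → ℝ D
    ℛᴬ D a t = map (λ ρ → 𝒯ᴬ (pred D) a (proj₁ ρ)) (reductions D t)

𝒯≤ : (D : ℕ) → Γ ⊢ A → 𝕋 D
𝒯≤ D = 𝒯ᴬ D (<-wellFounded D)

ℛ : (D : ℕ) → Γ ⊢ A → ℝ D
ℛ D t = map (λ ρ → 𝒯≤ (pred D) (proj₁ ρ)) (reductions D t)

𝒯ᵐ : (M : Λ Γ A) → 𝕋 (maxdeg ⌈ M ⌉)
𝒯ᵐ M = 𝒯≤ (maxdeg ⌈ M ⌉) ⌈ M ⌉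

-- The defining equation of 𝒯≤ in terms of ℛ.

𝒯-entry : (D : ℕ) (t : Γ ⊢ A) → Redex t → Maybe (Entry D)
𝒯-entry D t r with degree r ≤? D
... | yes d≤D = just (entry (degree r) (degree≥1 r) d≤D (ℛ (degree r) t))
... | no _    = nothing

private
  mutual
    𝒯ᴬ-irrelevant : ∀ D (a a′ : Acc _<_ D) (t : Γ ⊢ A) → 𝒯ᴬ D a t ≡ 𝒯ᴬ D a′ t
    𝒯ᴬ-irrelevant D a a′ t = mapMaybe-cong (𝒯ᴬ-entry-irrelevant D a a′ t) (redexes t)

    𝒯ᴬ-entry-irrelevant : ∀ D (a a′ : Acc _<_ D) (t : Γ ⊢ A) (r : Redex t) →
                          𝒯ᴬ-entry D a t r ≡ 𝒯ᴬ-entry D a′ t r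
    𝒯ᴬ-entry-irrelevant D (acc rs) (acc rs′) t r with degree r ≤? D
    ... | yes d≤D = cong (λ b → just (entry (degree r) (degree≥1 r) d≤D b))
                         (map-cong (λ ρ → 𝒯ᴬ-irrelevant (pred (degree r)) (rs (pred< (degree≥1 r) d≤D)) (rs′ _) (proj₁ ρ)) (reductions (degree r) t))
    ... | no _    = refl

  𝒯ᴬ-entry-unfold : ∀ D (a : Acc _<_ D) (t : Γ ⊢ A) (r : Redex t) → 𝒯ᴬ-entry D a t r ≡ 𝒯-entry D t r
  𝒯ᴬ-entry-unfold D (acc rs) t r with degree r ≤? D
  ... | yes d≤D = cong (λ b → just (entry (degree r) (degree≥1 r) d≤D b))
                       (map-cong (λ ρ → 𝒯ᴬ-irrelevant (pred (degree r)) (rs (pred< (degree≥1 r) d≤D)) (<-wellFounded _) (proj₁ ρ)) (reductions (degree r) t))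
  ... | no _    = refl

𝒯≤-unfold : ∀ D (t : Γ ⊢ A) → 𝒯≤ D t ≡ mapMaybe (𝒯-entry D t) (redexes t)
𝒯≤-unfold D t = mapMaybe-cong (𝒯ᴬ-entry-unfold D (<-wellFounded D) t) (redexes t)

{-# OPTIONS --safe #-}

-- A step M ⟶β N is the contraction of a redex r of ⌈ M ⌉ followed by the erasure
-- of memories.  Both effects are compared through simulations: if the redexes of
-- t have distinct copies in u whose contractions can again be completed to a
-- simulation, then 𝒯≤ D t is at most 𝒯≤ D u.
--
-- Erasure is such a simulation, so it does not increase the measure.  So is the
-- passage from t to its simplification at degree k, the contraction of all
-- redexes of degree k, as far as degrees below k are concerned: since
-- contraction keeps the argument in memory, no redex is ever lost.
--
-- The contraction of r, of degree d, decreases 𝒯≤ D for d ≤ D, by induction on D: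
-- each redex of contract r has degree i < d, or i ≥ d and then t has a redex of
-- degree i as well, so it suffices that ℛ i decreases for i ≥ d.  For i = d the
-- reductions of contract r are those of t which begin with r.  For i > d each reduct
-- u of contract r by steps of degree i has the same simplification at i as
-- contract r, and the simplification of t reduces to that one by at least one step
-- of degree d; hence 𝒯≤ (i - 1) u lies strictly below the value at the simplification
-- of t, which is an element of ℛ i t.
module Submission where

open import Data.Empty using (⊥; ⊥-elim)
open import Data.List.Base using (List; []; _∷_; _++_; map; mapMaybe; foldr)
open import Data.List.Membership.Propositional using (_∈_; lose)
open import Data.List.Membership.Propositional.Properties using (∈-map⁺; ∈-map⁻; ∈-∃++; ∈-++⁻)
open import Data.List.Properties using (mapMaybe-map; mapMaybe-just)
open import Data.List.Relation.Binary.Permutation.Homogeneous as Perm using (Permutation)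
open import Data.List.Relation.Binary.Permutation.Propositional as Prop using (_↭_)
open import Data.List.Relation.Binary.Permutation.Propositional.Properties using (mapMaybe-↭; shift; ∈-resp-↭; ++-comm) renaming (map⁺ to map-↭)
open import Data.List.Relation.Binary.Pointwise as Pointwise using (Pointwise; []; _∷_)
open import Data.List.Relation.Unary.All as All using (All; []; _∷_)
import Data.List.Relation.Unary.All.Properties as All
open import Data.List.Relation.Unary.AllPairs using ([]; _∷_)
open import Data.List.Relation.Unary.Any as Any using (Any; here; there)
import Data.List.Relation.Unary.Any.Properties as Any
open import Data.List.Relation.Unary.Unique.Propositional using (Unique)
open import Data.Maybe.Base using (Maybe; just; nothing; _>>=_)
open import Data.Maybe.Properties using (just-injective)
import Data.Maybe.Relation.Unary.All as Maybe
import Data.Maybe.Relation.Unary.Any as Maybe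
open import Data.Nat.Base using (ℕ; suc; _⊔_; _≤_; _<_; s≤s)
open import Data.Nat.Induction using (<-wellFounded)
open import Data.Nat.Properties using (_≟_; _≤?_; _<?_; ≤-reflexive; ≤-trans; ≤-irrelevant; ≡-irrelevant; <-trans; ≤-<-trans; <-≤-trans; <⇒≤; <⇒≢; ≰⇒>; n<1+n; m≤m⊔n; m≤n⊔m; m≤n⇒m<n∨m≡n)
open import Data.Product.Base using (∃; ∃₂; _×_; _,_; proj₁; proj₂)
open import Data.Sum.Base as Sum using (_⊎_; inj₁; inj₂)
open import Function.Base using (_∘_)
open import Induction.WellFounded using (Acc; acc)
open import Level using (0ℓ)
open import Relation.Binary.Construct.Closure.Transitive using () renaming ([_] to [_]⁺; _∷_ to _∷⁺_; _++_ to _++⁺_)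
open import Relation.Binary.Core using (Rel)
open import Relation.Binary.Definitions using (Reflexive; Symmetric)
open import Relation.Binary.PropositionalEquality using (_≡_; _≢_; refl; sym; trans; cong; cong₂; subst; subst₂)
open import Relation.Nullary using (¬_; yes; no)

open import Defs

private
  variable
    Base  : Set
    Γ Δ Θ : Ctx Base
    A B C : Ty Base
    d     : ℕ

-- Multisets

module Multiset {X : Set} (_≈_ _>_ : Rel X 0ℓ) (≈-refl : Reflexive _≈_) (≈-sym : Symmetric _≈_) where

  infix 4 _≋_ _≽_ _≻ᴹ_ _⪰_

  _≋_ _≻ᴹ_ _⪰_ : Rel (List X) 0ℓ
  _≋_  = Permutation _≈_
  _≻ᴹ_ = MultisetOrder _≈_ _>_
  xs ⪰ ys = xs ≻ᴹ ys ⊎ xs ≋ ys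

  _≽_ : Rel X 0ℓ
  x ≽ y = x > y ⊎ x ≈ y

  ≋-refl : Reflexive _≋_
  ≋-refl = Perm.refl (Pointwise.refl ≈-refl)

  ≋-sym : Symmetric _≋_
  ≋-sym = Perm.sym ≈-sym

  ↭⇒≋ : ∀ {xs ys} → xs ↭ ys → xs ≋ ys
  ↭⇒≋ Prop.refl         = ≋-refl
  ↭⇒≋ (Prop.prep x p)   = Perm.prep ≈-refl (↭⇒≋ p)
  ↭⇒≋ (Prop.swap x y p) = Perm.swap ≈-refl ≈-refl (↭⇒≋ p)
  ↭⇒≋ (Prop.trans p q)  = Perm.trans (↭⇒≋ p) (↭⇒≋ q)

  ≻-respˡ : ∀ {xs ys zs} → xs ≋ ys → ys ≻ᴹ zs → xs ≻ᴹ zs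
  ≻-respˡ e [ replace ms x ns p q a ]⁺    = [ replace ms x ns (Perm.trans e p) q a ]⁺
  ≻-respˡ e (replace ms x ns p q a ∷⁺ rs) = replace ms x ns (Perm.trans e p) q a ∷⁺ rs

  ≻-respʳ : ∀ {xs ys zs} → xs ≻ᴹ ys → ys ≋ zs → xs ≻ᴹ zs
  ≻-respʳ [ replace ms x ns p q a ]⁺ e = [ replace ms x ns p (Perm.trans (≋-sym e) q) a ]⁺
  ≻-respʳ (r ∷⁺ rs)                  e = r ∷⁺ ≻-respʳ rs e

  ≻-⪰-trans : ∀ {xs ys zs} → xs ≻ᴹ ys → ys ⪰ zs → xs ≻ᴹ zs
  ≻-⪰-trans p (inj₁ q) = p ++⁺ q
  ≻-⪰-trans p (inj₂ e) = ≻-respʳ p e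

  ⪰-≋-trans : ∀ {xs ys zs} → xs ⪰ ys → ys ≋ zs → xs ⪰ zs
  ⪰-≋-trans (inj₁ p) e  = inj₁ (≻-respʳ p e)
  ⪰-≋-trans (inj₂ e′) e = inj₂ (Perm.trans e′ e)

  ≋-⪰-trans : ∀ {xs ys zs} → xs ≋ ys → ys ⪰ zs → xs ⪰ zs
  ≋-⪰-trans e (inj₁ p)  = inj₁ (≻-respˡ e p)
  ≋-⪰-trans e (inj₂ e′) = inj₂ (Perm.trans e e′)

  ∷-mono-≻ : ∀ x {xs ys} → xs ≻ᴹ ys → x ∷ xs ≻ᴹ x ∷ ys
  ∷-mono-≻ x [ replace ms y ns p q a ]⁺    = [ replace (x ∷ ms) y ns (Perm.prep ≈-refl p) (Perm.prep ≈-refl q) a ]⁺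
  ∷-mono-≻ x (replace ms y ns p q a ∷⁺ rs) =
    replace (x ∷ ms) y ns (Perm.prep ≈-refl p) (Perm.prep ≈-refl q) a ∷⁺ ∷-mono-≻ x rs

  ∷-mono-⪰ : ∀ x {xs ys} → xs ⪰ ys → x ∷ xs ⪰ x ∷ ys
  ∷-mono-⪰ x (inj₁ p) = inj₁ (∷-mono-≻ x p)
  ∷-mono-⪰ x (inj₂ e) = inj₂ (Perm.prep ≈-refl e)

  ++-mono-⪰ : ∀ zs {xs ys} → xs ⪰ ys → zs ++ xs ⪰ zs ++ ys
  ++-mono-⪰ []       p = p
  ++-mono-⪰ (w ∷ ws) p = ∷-mono-⪰ w (++-mono-⪰ ws p)

  replace-head : ∀ {x ns} xs → All (x >_) ns → x ∷ xs ≻ᴹ ns ++ xs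
  replace-head {x} {ns} xs a =
    [ replace xs x ns (↭⇒≋ (++-comm (x ∷ []) xs)) (↭⇒≋ (++-comm ns xs)) a ]⁺

  ∷-⪰ : ∀ {x y xs ys} → x ≽ y → xs ⪰ ys → x ∷ xs ⪰ y ∷ ys
  ∷-⪰ {xs = xs} (inj₁ x>y) p = inj₁ (≻-⪰-trans (replace-head xs (x>y ∷ [])) (∷-mono-⪰ _ p))
  ∷-⪰ {x}       (inj₂ x≈y) p = ⪰-≋-trans (∷-mono-⪰ x p) (Perm.prep x≈y ≋-refl)

  ∷-≻ : ∀ {x xs ys} → xs ⪰ ys → x ∷ xs ≻ᴹ ys
  ∷-≻ {xs = xs} = ≻-⪰-trans (replace-head xs [])

  -- Each `y` follows the witness of its domination: those witnessed by `x` go to `ns`, the others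
  -- stay dominated by `xs`. This permits induction on the dominating list.
  split-dominated : ∀ {x xs} ys → All (λ y → Any (_> y) (x ∷ xs)) ys →
    ∃₂ λ ns zs → ys ↭ ns ++ zs × All (x >_) ns × All (λ y → Any (_> y) xs) zs
  split-dominated []       []             = [] , [] , Prop.refl , [] , []
  split-dominated (y ∷ ys) (a ∷ as) with split-dominated ys as
  split-dominated (y ∷ ys) (here x>y ∷ _) | ns , zs , p , b , c =
    y ∷ ns , zs , Prop.prep y p , x>y ∷ b , c
  split-dominated (y ∷ ys) (there a ∷ _)  | ns , zs , p , b , c =
    ns , y ∷ zs , Prop.trans (Prop.prep y p) (Prop.↭-sym (shift y ns zs)) , b , a ∷ c

  -- `x` is replaced by the elements assigned to it, and the recursion treats the tail. The
  -- replacement takes place even when `ns` is empty, which makes the result strict.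
  dominated-∷ : ∀ x xs {ys} → All (λ y → Any (_> y) (x ∷ xs)) ys → x ∷ xs ≻ᴹ ys
  dominated-⪰ : ∀ xs {ys} → All (λ y → Any (_> y) xs) ys → xs ⪰ ys

  dominated-∷ x xs {ys} a with split-dominated ys a
  ... | ns , zs , p , b , c =
    ≻-respʳ (≻-⪰-trans (replace-head xs b) (++-mono-⪰ ns (dominated-⪰ xs c))) (≋-sym (↭⇒≋ p))

  dominated-⪰ []       []       = inj₂ ≋-refl
  dominated-⪰ []       (() ∷ _)
  dominated-⪰ (x ∷ xs) a        = inj₁ (dominated-∷ x xs a)

  -- The case of the Dershowitz-Manna criterion in which nothing is kept in common. Several elements
  -- of `ys` may share one dominating element; `x ∈ xs` supplies nonemptiness.
  dominated : ∀ {x xs ys} → x ∈ xs → All (λ y → Any (_> y) xs) ys → xs ≻ᴹ ys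
  dominated {xs = x ∷ xs} _ a = dominated-∷ x xs a

  -- `nothing` marks an index that contributes no element. The larger side may have an unmatched
  -- element, the smaller side may not.
  data _≽?_ : Rel (Maybe X) 0ℓ where
    absent  : ∀ {m} → m ≽? nothing
    present : ∀ {x y} → x ≽ y → just x ≽? just y

  ⪰-[] : ∀ xs → xs ⪰ []
  ⪰-[] xs = dominated-⪰ xs []

  -- `f` matches the elements on the right with elements on the left. Unmatched elements, those from
  -- `rest` among them, only enlarge the left side.
  mapMaybe-⪰ : {Y Z : Set} {f : Y → Maybe Z} {g : Y → Maybe X} {h : Z → Maybe X} {rest : List Z} →
               (∀ y → (f y >>= h) ≽? g y) → ∀ ys → mapMaybe h (mapMaybe f ys ++ rest) ⪰ mapMaybe g ys
  mapMaybe-⪰ p [] = ⪰-[] _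
  mapMaybe-⪰ {f = f} {g} {h} p (y ∷ ys) with f y | g y | p y
  ... | nothing | nothing | _  = mapMaybe-⪰ {g = g} p ys
  ... | just w  | b       | p′ with h w | b | p′
  ...   | just x  | nothing | _         = inj₁ (∷-≻ (mapMaybe-⪰ {g = g} p ys))
  ...   | nothing | nothing | _         = mapMaybe-⪰ {g = g} p ys
  ...   | just x  | just x′ | present r = ∷-⪰ r (mapMaybe-⪰ {g = g} p ys)

-- Comparison of multisets along injections of finite types

unique-⊆ : {Y : Set} {xs : List Y} → Unique xs → ∀ ys → (∀ {x} → x ∈ xs → x ∈ ys) →
           ∃ λ rest → ys ↭ xs ++ rest
unique-⊆ []      ys sub = ys , Prop.refl
unique-⊆ {xs = x ∷ xs} (x∉ ∷ u) ys sub with ∈-∃++ (sub (here refl))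
... | us , vs , refl with unique-⊆ u (us ++ vs) sub′
  where
  sub′ : ∀ {x′} → x′ ∈ xs → x′ ∈ us ++ vs
  sub′ q with ∈-resp-↭ (shift x us vs) (sub (there q))
  ... | here refl = ⊥-elim (All.lookup x∉ q refl)
  ... | there q′  = q′
... | rest , p = rest , Prop.trans (shift x us vs) (Prop.prep x p)

PartialInjective : {Y Z : Set} → (Y → Maybe Z) → Set
PartialInjective f = ∀ {x y w} → f x ≡ just w → f y ≡ just w → x ≡ y

mapMaybe-unique : {Y Z : Set} (f : Y → Maybe Z) → PartialInjective f → ∀ {ys} → Unique ys → Unique (mapMaybe f ys)
mapMaybe-unique f inj []                 = []
mapMaybe-unique f inj {y ∷ ys} (y∉ ∷ u) with f y in eq
... | nothing = mapMaybe-unique f inj u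
... | just w  = avoids ys y∉ ∷ mapMaybe-unique f inj u
  where
  avoids : ∀ ys → All (y ≢_) ys → All (w ≢_) (mapMaybe f ys)
  avoids []        []          = []
  avoids (y′ ∷ ys) (y≢y′ ∷ as) with f y′ in eq′
  ... | nothing = avoids ys as
  ... | just w′ = (λ { refl → y≢y′ (inj eq eq′) }) ∷ avoids ys as

-- Completeness puts the image inside the list of `Z`, and injectivity keeps it free of repetitions,
-- so it can be split off.
image-split : {Y Z : Set} (eʸ : Enumeration Y) (eᶻ : Enumeration Z) (f : Y → Maybe Z) → PartialInjective f →
              ∃ λ rest → elements eᶻ ↭ mapMaybe f (elements eʸ) ++ rest
image-split eʸ eᶻ f inj =
  unique-⊆ (mapMaybe-unique f inj (unique eʸ)) (elements eᶻ) (λ {w} _ → complete eᶻ w)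

mapMaybe-just∘ : {Y Z : Set} (f : Y → Z) (ys : List Y) → mapMaybe (λ y → just (f y)) ys ≡ map f ys
mapMaybe-just∘ f ys = trans (sym (mapMaybe-map just f ys)) (mapMaybe-just (map f ys))

module Image {X : Set} (_≈_ _>_ : Rel X 0ℓ) (≈-refl : Reflexive _≈_) (≈-sym : Symmetric _≈_)
             {Y Z : Set} (eʸ : Enumeration Y) (eᶻ : Enumeration Z) where

  open Multiset _≈_ _>_ ≈-refl ≈-sym

  mapMaybe-image : (f : Y → Maybe Z) → PartialInjective f →
                   {g : Y → Maybe X} {h : Z → Maybe X} → (∀ y → (f y >>= h) ≽? g y) →
                   mapMaybe h (elements eᶻ) ⪰ mapMaybe g (elements eʸ)
  mapMaybe-image f inj {h = h} p with image-split eʸ eᶻ f inj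
  ... | rest , q = ≋-⪰-trans (↭⇒≋ (mapMaybe-↭ h q)) (mapMaybe-⪰ {rest = rest} p (elements eʸ))

  module _ (f : Y → Z) (f-injective : ∀ {x y} → f x ≡ f y → x ≡ y)
           {g : Y → X} {h : Z → X} (p : ∀ y → h (f y) ≽ g y) where

    private
      just∘f-injective : PartialInjective (λ y → just (f y))
      just∘f-injective e e′ = f-injective (just-injective (trans e (sym e′)))

    map-image : map h (elements eᶻ) ⪰ map g (elements eʸ)
    map-image = subst₂ _⪰_ (mapMaybe-just∘ h (elements eᶻ)) (mapMaybe-just∘ g (elements eʸ))
                  (mapMaybe-image (λ y → just (f y)) just∘f-injective (λ y → present (p y)))

    -- An element outside the image must lie in `rest`, and discarding one element of `rest` is
    -- already a strict step.
    map-image-strict : (∃ λ w → ∀ y → f y ≢ w) → map h (elements eᶻ) ≻ᴹ map g (elements eʸ)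
    map-image-strict (w₀ , w₀∉) with image-split eʸ eᶻ (λ y → just (f y)) just∘f-injective
    ... | [] , q =
      ⊥-elim (absurd (∈-++⁻ (mapMaybe (λ y → just (f y)) (elements eʸ)) (∈-resp-↭ q (complete eᶻ w₀))))
      where
      absurd : w₀ ∈ mapMaybe (λ y → just (f y)) (elements eʸ) ⊎ w₀ ∈ [] → ⊥
      absurd (inj₁ i) with ∈-map⁻ f (subst (w₀ ∈_) (mapMaybe-just∘ f (elements eʸ)) i)
      ... | y , _ , e = w₀∉ y (sym e)
    ... | w ∷ rest , q =
      ≻-respˡ (↭⇒≋ (map-↭ h (Prop.trans q (shift w _ rest))))
              (∷-≻ (subst₂ _⪰_ (mapMaybe-just∘ h (mapMaybe (λ y → just (f y)) (elements eʸ) ++ rest))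
                               (mapMaybe-just∘ g (elements eʸ))
                               (mapMaybe-⪰ {rest = rest} (λ y → present (p y)) (elements eʸ))))

-- Renaming and substitution

rename-cong : {ξ ζ : Ren Γ Δ} → (∀ {B} (x : Γ ∋ B) → ξ x ≡ ζ x) → (t : Γ ⊢ A) → rename ξ t ≡ rename ζ t
rename-cong p (var x)   = cong var (p x)
rename-cong p (ƛ t)     = cong ƛ_ (rename-cong (λ { z → refl ; (s x) → cong s (p x) }) t)
rename-cong p (t · u)   = cong₂ _·_ (rename-cong p t) (rename-cong p u)
rename-cong p (t ❴ u ❵) = cong₂ _❴_❵ (rename-cong p t) (rename-cong p u)

substitute-cong : {σ τ : Sub Γ Δ} → (∀ {B} (x : Γ ∋ B) → σ x ≡ τ x) → (t : Γ ⊢ A) →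
                  substitute σ t ≡ substitute τ t
substitute-cong p (var x)   = p x
substitute-cong p (ƛ t)     = cong ƛ_ (substitute-cong (λ { z → refl ; (s x) → cong (rename s) (p x) }) t)
substitute-cong p (t · u)   = cong₂ _·_ (substitute-cong p t) (substitute-cong p u)
substitute-cong p (t ❴ u ❵) = cong₂ _❴_❵ (substitute-cong p t) (substitute-cong p u)

rename-rename : (ξ : Ren Δ Θ) (ζ : Ren Γ Δ) (t : Γ ⊢ A) → rename ξ (rename ζ t) ≡ rename (ξ ∘ ζ) t
rename-rename ξ ζ (var x)   = refl
rename-rename ξ ζ (ƛ t)     = cong ƛ_ (trans (rename-rename (extᴿ ξ) (extᴿ ζ) t)
                                             (rename-cong (λ { z → refl ; (s x) → refl }) t))
rename-rename ξ ζ (t · u)   = cong₂ _·_ (rename-rename ξ ζ t) (rename-rename ξ ζ u)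
rename-rename ξ ζ (t ❴ u ❵) = cong₂ _❴_❵ (rename-rename ξ ζ t) (rename-rename ξ ζ u)

substitute-rename : (σ : Sub Δ Θ) (ξ : Ren Γ Δ) (t : Γ ⊢ A) →
                    substitute σ (rename ξ t) ≡ substitute (λ x → σ (ξ x)) t
substitute-rename σ ξ (var x)   = refl
substitute-rename σ ξ (ƛ t)     = cong ƛ_ (trans (substitute-rename (exts σ) (extᴿ ξ) t)
                                                 (substitute-cong (λ { z → refl ; (s x) → refl }) t))
substitute-rename σ ξ (t · u)   = cong₂ _·_ (substitute-rename σ ξ t) (substitute-rename σ ξ u)
substitute-rename σ ξ (t ❴ u ❵) = cong₂ _❴_❵ (substitute-rename σ ξ t) (substitute-rename σ ξ u)

rename-substitute : (ξ : Ren Δ Θ) (σ : Sub Γ Δ) (t : Γ ⊢ A) →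
                    rename ξ (substitute σ t) ≡ substitute (λ x → rename ξ (σ x)) t
rename-substitute ξ σ (var x)   = refl
rename-substitute ξ σ (ƛ t)     = cong ƛ_ (trans (rename-substitute (extᴿ ξ) (exts σ) t) (substitute-cong
  (λ { z → refl ; (s x) → trans (rename-rename (extᴿ ξ) s (σ x)) (sym (rename-rename s ξ (σ x))) }) t))
rename-substitute ξ σ (t · u)   = cong₂ _·_ (rename-substitute ξ σ t) (rename-substitute ξ σ u)
rename-substitute ξ σ (t ❴ u ❵) = cong₂ _❴_❵ (rename-substitute ξ σ t) (rename-substitute ξ σ u)

substitute-substitute : (τ : Sub Δ Θ) (σ : Sub Γ Δ) (t : Γ ⊢ A) →
                        substitute τ (substitute σ t) ≡ substitute (λ x → substitute τ (σ x)) t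
substitute-substitute τ σ (var x)   = refl
substitute-substitute τ σ (ƛ t)     = cong ƛ_ (trans (substitute-substitute (exts τ) (exts σ) t) (substitute-cong
  (λ { z → refl ; (s x) → trans (substitute-rename (exts τ) s (σ x)) (sym (rename-substitute s τ (σ x))) }) t))
substitute-substitute τ σ (t · u)   = cong₂ _·_ (substitute-substitute τ σ t) (substitute-substitute τ σ u)
substitute-substitute τ σ (t ❴ u ❵) = cong₂ _❴_❵ (substitute-substitute τ σ t) (substitute-substitute τ σ u)

rename≡substitute : (ξ : Ren Γ Δ) (t : Γ ⊢ A) → rename ξ t ≡ substitute (λ x → var (ξ x)) t
rename≡substitute ξ (var x)   = refl
rename≡substitute ξ (ƛ t)     = cong ƛ_ (trans (rename≡substitute (extᴿ ξ) t)
                                               (substitute-cong (λ { z → refl ; (s x) → refl }) t))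
rename≡substitute ξ (t · u)   = cong₂ _·_ (rename≡substitute ξ t) (rename≡substitute ξ u)
rename≡substitute ξ (t ❴ u ❵) = cong₂ _❴_❵ (rename≡substitute ξ t) (rename≡substitute ξ u)

substitute-var : (t : Γ ⊢ A) → substitute var t ≡ t
substitute-var (var x)   = refl
substitute-var (ƛ t)     = cong ƛ_ (trans (substitute-cong (λ { z → refl ; (s x) → refl }) t) (substitute-var t))
substitute-var (t · u)   = cong₂ _·_ (substitute-var t) (substitute-var u)
substitute-var (t ❴ u ❵) = cong₂ _❴_❵ (substitute-var t) (substitute-var u)

substitute-[] : (σ : Sub Γ Δ) (t : Γ ▸ A ⊢ B) (v : Γ ⊢ A) →
                substitute (exts σ) t [ substitute σ v ] ≡ substitute σ (t [ v ])
substitute-[] σ t v = trans (substitute-substitute (single (substitute σ v)) (exts σ) t)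
  (trans (substitute-cong (λ { z → refl ; (s x) → trans (substitute-rename (single (substitute σ v)) s (σ x))
                                                        (substitute-var (σ x)) }) t)
         (sym (substitute-substitute σ (single v) t)))

-- Redexes under substitution

substituteᴹ : (σ : Sub Γ Δ) {u : Γ ⊢ A ⇒ B} → MAbs u → MAbs (substitute σ u)
substituteᴹ σ (lam t)   = lam (substitute (exts σ) t)
substituteᴹ σ (mem m r) = mem (substituteᴹ σ m) (substitute σ r)

substituteᴿ : (σ : Sub Γ Δ) {t : Γ ⊢ A} → Redex t → Redex (substitute σ t)
substituteᴿ σ (root m)  = root (substituteᴹ σ m)
substituteᴿ σ (in-ƛ r)  = in-ƛ (substituteᴿ (exts σ) r)
substituteᴿ σ (app-l r) = app-l (substituteᴿ σ r)
substituteᴿ σ (app-r r) = app-r (substituteᴿ σ r)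
substituteᴿ σ (mem-l r) = mem-l (substituteᴿ σ r)
substituteᴿ σ (mem-r r) = mem-r (substituteᴿ σ r)

substituteᴿ-degree : (σ : Sub Γ Δ) {t : Γ ⊢ A} (r : Redex t) → degree (substituteᴿ σ r) ≡ degree r
substituteᴿ-degree σ (root m)  = refl
substituteᴿ-degree σ (in-ƛ r)  = substituteᴿ-degree (exts σ) r
substituteᴿ-degree σ (app-l r) = substituteᴿ-degree σ r
substituteᴿ-degree σ (app-r r) = substituteᴿ-degree σ r
substituteᴿ-degree σ (mem-l r) = substituteᴿ-degree σ r
substituteᴿ-degree σ (mem-r r) = substituteᴿ-degree σ r

contract-root-substitute : (σ : Sub Γ Δ) {u : Γ ⊢ A ⇒ B} (m : MAbs u) (v : Γ ⊢ A) →
  contract (root {v = substitute σ v} (substituteᴹ σ m)) ≡ substitute σ (contract (root {v = v} m))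
contract-root-substitute σ (lam t)   v = cong (_❴ substitute σ v ❵) (substitute-[] σ t v)
contract-root-substitute σ (mem m r) v = cong (_❴ substitute σ r ❵) (contract-root-substitute σ m v)

contract-substitute : (σ : Sub Γ Δ) {t : Γ ⊢ A} (r : Redex t) →
                      contract (substituteᴿ σ r) ≡ substitute σ (contract r)
contract-substitute σ (root {v = v} m)    = contract-root-substitute σ m v
contract-substitute σ (in-ƛ r)            = cong ƛ_ (contract-substitute (exts σ) r)
contract-substitute σ (app-l {v = v} r)   = cong (_· substitute σ v) (contract-substitute σ r)
contract-substitute σ (app-r {u = u} r)   = cong (substitute σ u ·_) (contract-substitute σ r)
contract-substitute σ (mem-l {r = u} r)   = cong (_❴ substitute σ u ❵) (contract-substitute σ r)
contract-substitute σ (mem-r {t = t} r)   = cong (substitute σ t ❴_❵) (contract-substitute σ r)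

root-irrelevant : {u : Γ ⊢ A ⇒ B} {v : Γ ⊢ A} (m n : MAbs u) → root {v = v} m ≡ root n
root-irrelevant m n = cong root (MAbs-irrelevant m n)

in-ƛ-injective : {t : Γ ▸ A ⊢ B} {q r : Redex t} → in-ƛ q ≡ in-ƛ r → q ≡ r
in-ƛ-injective refl = refl

app-l-injective : {u : Γ ⊢ A ⇒ B} {v : Γ ⊢ A} {q r : Redex u} → app-l {v = v} q ≡ app-l r → q ≡ r
app-l-injective refl = refl

app-r-injective : {u : Γ ⊢ A ⇒ B} {v : Γ ⊢ A} {q r : Redex v} → app-r {u = u} q ≡ app-r r → q ≡ r
app-r-injective refl = refl

mem-l-injective : {t : Γ ⊢ A} {u : Γ ⊢ B} {q r : Redex t} → mem-l {r = u} q ≡ mem-l r → q ≡ r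
mem-l-injective refl = refl

mem-r-injective : {t : Γ ⊢ A} {u : Γ ⊢ B} {q r : Redex u} → mem-r {t = t} q ≡ mem-r r → q ≡ r
mem-r-injective refl = refl

substituteᴿ-injective : (σ : Sub Γ Δ) {t : Γ ⊢ A} (q r : Redex t) → substituteᴿ σ q ≡ substituteᴿ σ r → q ≡ r
substituteᴿ-injective σ (root m)  (root n)  e = root-irrelevant m n
substituteᴿ-injective σ (in-ƛ q)  (in-ƛ r)  e = cong in-ƛ (substituteᴿ-injective (exts σ) q r (in-ƛ-injective e))
substituteᴿ-injective σ (app-l q) (app-l r) e = cong app-l (substituteᴿ-injective σ q r (app-l-injective e))
substituteᴿ-injective σ (app-r q) (app-r r) e = cong app-r (substituteᴿ-injective σ q r (app-r-injective e))
substituteᴿ-injective σ (mem-l q) (mem-l r) e = cong mem-l (substituteᴿ-injective σ q r (mem-l-injective e))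
substituteᴿ-injective σ (mem-r q) (mem-r r) e = cong mem-r (substituteᴿ-injective σ q r (mem-r-injective e))
substituteᴿ-injective σ (root m)  (app-l r) ()
substituteᴿ-injective σ (root m)  (app-r r) ()
substituteᴿ-injective σ (app-l q) (root m)  ()
substituteᴿ-injective σ (app-l q) (app-r r) ()
substituteᴿ-injective σ (app-r q) (root m)  ()
substituteᴿ-injective σ (app-r q) (app-l r) ()
substituteᴿ-injective σ (mem-l q) (mem-r r) ()
substituteᴿ-injective σ (mem-r q) (mem-l r) ()

-- Reductions of a fixed degree

infixr 5 _⨾_

_⨾_ : {t u v : Γ ⊢ A} → Reduction d t u → Reduction d u v → Reduction d t v
done       ⨾ q = q
step r e p ⨾ q = step r e (p ⨾ q)

-- The contractum of `Fᴿ r` need only reduce to `F (contract r)` by steps of the same degree; this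
-- leaves room for an `F` that duplicates redexes.
reduction-map : (F : Γ ⊢ A → Δ ⊢ B) (Fᴿ : ∀ {t} → Redex t → Redex (F t)) →
                (∀ {t} (r : Redex t) → degree (Fᴿ r) ≡ degree r) →
                (∀ {t} (r : Redex t) → degree r ≡ d → Reduction d (contract (Fᴿ r)) (F (contract r))) →
                {t u : Γ ⊢ A} → Reduction d t u → Reduction d (F t) (F u)
reduction-map F Fᴿ deg con done         = done
reduction-map F Fᴿ deg con (step r e p) =
  step (Fᴿ r) (trans (deg r) e) (con r e ⨾ reduction-map F Fᴿ deg con p)

≡⇒reduction : {t u : Γ ⊢ A} → t ≡ u → Reduction d t u
≡⇒reduction refl = done

reduction-ƛ : {t u : Γ ▸ A ⊢ B} → Reduction d t u → Reduction d (ƛ t) (ƛ u)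
reduction-ƛ = reduction-map ƛ_ in-ƛ (λ _ → refl) (λ _ _ → done)

reduction-· : {t t′ : Γ ⊢ A ⇒ B} {u u′ : Γ ⊢ A} → Reduction d t t′ → Reduction d u u′ →
              Reduction d (t · u) (t′ · u′)
reduction-· {t′ = t′} {u} p q =
  reduction-map (_· u) app-l (λ _ → refl) (λ _ _ → done) p ⨾
  reduction-map (t′ ·_) app-r (λ _ → refl) (λ _ _ → done) q

reduction-❴❵ : {t t′ : Γ ⊢ A} {u u′ : Γ ⊢ B} → Reduction d t t′ → Reduction d u u′ →
               Reduction d (t ❴ u ❵) (t′ ❴ u′ ❵)
reduction-❴❵ {t′ = t′} {u} p q =
  reduction-map (_❴ u ❵) mem-l (λ _ → refl) (λ _ _ → done) p ⨾
  reduction-map (t′ ❴_❵) mem-r (λ _ → refl) (λ _ _ → done) q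

reduction-substitute : (σ : Sub Γ Δ) {t u : Γ ⊢ A} → Reduction d t u →
                       Reduction d (substitute σ t) (substitute σ u)
reduction-substitute σ = reduction-map (substitute σ) (substituteᴿ σ) (substituteᴿ-degree σ)
                                       (λ r _ → ≡⇒reduction (contract-substitute σ r))

reduction-rename : (ξ : Ren Γ Δ) {t u : Γ ⊢ A} → Reduction d t u → Reduction d (rename ξ t) (rename ξ u)
reduction-rename ξ {t} {u} p = subst₂ (Reduction _) (sym (rename≡substitute ξ t)) (sym (rename≡substitute ξ u))
                                      (reduction-substitute (λ x → var (ξ x)) p)

-- The reduction of `σ x` is repeated at each occurrence of `x`; an absent variable contributes no
-- step.
reduction-substituteʳ : {σ τ : Sub Γ Δ} → (∀ {B} (x : Γ ∋ B) → Reduction d (σ x) (τ x)) →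
                        (t : Γ ⊢ A) → Reduction d (substitute σ t) (substitute τ t)
reduction-substituteʳ p (var x)   = p x
reduction-substituteʳ p (ƛ t)     =
  reduction-ƛ (reduction-substituteʳ (λ { z → done ; (s x) → reduction-rename s (p x) }) t)
reduction-substituteʳ p (t · u)   = reduction-· (reduction-substituteʳ p t) (reduction-substituteʳ p u)
reduction-substituteʳ p (t ❴ u ❵) = reduction-❴❵ (reduction-substituteʳ p t) (reduction-substituteʳ p u)

reduction-[]ʳ : (t : Γ ▸ A ⊢ B) {u v : Γ ⊢ A} → Reduction d u v → Reduction d (t [ u ]) (t [ v ])
reduction-[]ʳ t p = reduction-substituteʳ (λ { z → p ; (s x) → done }) t

-- Creation of redexes

contractᴹ : {u : Γ ⊢ A ⇒ B} → MAbs u → (r : Redex u) → MAbs (contract r)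
contractᴹ (lam t)   (in-ƛ r)  = lam (contract r)
contractᴹ (mem m u) (mem-l r) = mem (contractᴹ m r) u
contractᴹ (mem m u) (mem-r r) = mem m (contract r)

-- An abstraction newly appears at the head only as the result of a redex contracted there. Its type
-- is then the codomain of the function type of that redex, hence of smaller height.
contractᴹ⁻¹ : {u : Γ ⊢ A ⇒ B} (r : Redex u) → MAbs (contract r) → MAbs u ⊎ height (A ⇒ B) < degree r
contractᴹ⁻¹ (root {A = C} m)       _          = inj₂ (s≤s (m≤n⊔m (height C) _))
contractᴹ⁻¹ (in-ƛ {t = t} r)       _          = inj₁ (lam t)
contractᴹ⁻¹ (mem-l {r = u} r)      (mem m .u) with contractᴹ⁻¹ r m
... | inj₁ m′ = inj₁ (mem m′ u)
... | inj₂ lt = inj₂ lt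
contractᴹ⁻¹ (mem-r {r = u} r)      (mem m _)  = inj₁ (mem m u)

HasRedex : ℕ → Γ ⊢ A → Set
HasRedex d t = ∃ λ (r : Redex t) → degree r ≡ d

hasRedex-map : {t : Γ ⊢ A} {u : Δ ⊢ B} (f : Redex t → Redex u) → (∀ r → degree (f r) ≡ degree r) →
               HasRedex d t → HasRedex d u
hasRedex-map f p (r , e) = f r , trans (p r) e

renameᴹ⁻¹ : (ξ : Ren Γ Δ) (u : Γ ⊢ A ⇒ B) → MAbs (rename ξ u) → MAbs u
renameᴹ⁻¹ ξ (ƛ t)     _         = lam t
renameᴹ⁻¹ ξ (t ❴ u ❵) (mem m _) = mem (renameᴹ⁻¹ ξ t m) u

rename-hasRedex⁻¹ : (ξ : Ren Γ Δ) (t : Γ ⊢ A) → HasRedex d (rename ξ t) → HasRedex d t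
rename-hasRedex⁻¹ ξ (ƛ t)     (in-ƛ r , e)  = hasRedex-map in-ƛ (λ _ → refl) (rename-hasRedex⁻¹ (extᴿ ξ) t (r , e))
rename-hasRedex⁻¹ ξ (t · u)   (root m , e)  = root (renameᴹ⁻¹ ξ t m) , e
rename-hasRedex⁻¹ ξ (t · u)   (app-l r , e) = hasRedex-map app-l (λ _ → refl) (rename-hasRedex⁻¹ ξ t (r , e))
rename-hasRedex⁻¹ ξ (t · u)   (app-r r , e) = hasRedex-map app-r (λ _ → refl) (rename-hasRedex⁻¹ ξ u (r , e))
rename-hasRedex⁻¹ ξ (t ❴ u ❵) (mem-l r , e) = hasRedex-map mem-l (λ _ → refl) (rename-hasRedex⁻¹ ξ t (r , e))
rename-hasRedex⁻¹ ξ (t ❴ u ❵) (mem-r r , e) = hasRedex-map mem-r (λ _ → refl) (rename-hasRedex⁻¹ ξ u (r , e))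

-- Substituting an abstraction for a variable in function position creates a redex whose degree is
-- the height of the type of the variable. Inertness excludes this at degree `d`.
Inert : {Base : Set} {Γ Δ : Ctx Base} → ℕ → Sub Γ Δ → Set
Inert {Base} {Γ} d σ = {A B : Ty Base} (x : Γ ∋ A ⇒ B) → height (A ⇒ B) ≡ d → ¬ MAbs (σ x)

exts-inert : {σ : Sub Γ Δ} → Inert d σ → Inert d (exts {A = C} σ)
exts-inert         p z     e ()
exts-inert {σ = σ} p (s x) e m = p x e (renameᴹ⁻¹ s (σ x) m)

single-inert : (v : Γ ⊢ A) → height A < d → Inert d (single v)
single-inert v h z     e _ = <⇒≢ h e
single-inert v h (s x) e ()

substituteᴹ⁻¹ : {σ : Sub Γ Δ} → Inert d σ → (u : Γ ⊢ A ⇒ B) → height (A ⇒ B) ≡ d → MAbs (substitute σ u) → MAbs u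
substituteᴹ⁻¹ p (var x)   e m         = ⊥-elim (p x e m)
substituteᴹ⁻¹ p (ƛ t)     e _         = lam t
substituteᴹ⁻¹ p (t ❴ u ❵) e (mem m _) = mem (substituteᴹ⁻¹ p t e m) u

-- Inertness rules out the remaining source of redexes, a variable in function position that becomes
-- an abstraction.
substitute-hasRedex⁻¹ : {σ : Sub Γ Δ} → Inert d σ → (t : Γ ⊢ A) → HasRedex d (substitute σ t) →
                        HasRedex d t ⊎ ∃₂ λ B (x : Γ ∋ B) → HasRedex d (σ x)
substitute-hasRedex⁻¹ p (var x) q = inj₂ (_ , x , q)
substitute-hasRedex⁻¹ {σ = σ} p (ƛ t) (in-ƛ r , e)
  with substitute-hasRedex⁻¹ (exts-inert {σ = σ} p) t (r , e)
... | inj₁ q             = inj₁ (hasRedex-map in-ƛ (λ _ → refl) q)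
... | inj₂ (_ , s x , q) = inj₂ (_ , x , rename-hasRedex⁻¹ s (σ x) q)
substitute-hasRedex⁻¹ p (t · u) (root m , e) = inj₁ (root (substituteᴹ⁻¹ p t e m) , e)
substitute-hasRedex⁻¹ p (t · u) (app-l r , e) =
  Sum.map₁ (hasRedex-map app-l (λ _ → refl)) (substitute-hasRedex⁻¹ p t (r , e))
substitute-hasRedex⁻¹ p (t · u) (app-r r , e) =
  Sum.map₁ (hasRedex-map app-r (λ _ → refl)) (substitute-hasRedex⁻¹ p u (r , e))
substitute-hasRedex⁻¹ p (t ❴ u ❵) (mem-l r , e) =
  Sum.map₁ (hasRedex-map mem-l (λ _ → refl)) (substitute-hasRedex⁻¹ p t (r , e))
substitute-hasRedex⁻¹ p (t ❴ u ❵) (mem-r r , e) =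
  Sum.map₁ (hasRedex-map mem-r (λ _ → refl)) (substitute-hasRedex⁻¹ p u (r , e))

-- As the argument has height below `d`, substituting it creates no redex of degree `d`; every such
-- redex comes from the body, the memory or a copy of `v`.
contract-root-hasRedex⁻¹ : {u : Γ ⊢ A ⇒ B} (m : MAbs u) (v : Γ ⊢ A) → height A < d →
                           HasRedex d (contract (root {v = v} m)) → HasRedex d u ⊎ HasRedex d v
contract-root-hasRedex⁻¹ (lam t) v h (mem-l r , e) with substitute-hasRedex⁻¹ (single-inert v h) t (r , e)
... | inj₁ q           = inj₁ (hasRedex-map in-ƛ (λ _ → refl) q)
... | inj₂ (_ , z , q) = inj₂ q
contract-root-hasRedex⁻¹ (lam t)   v h (mem-r r , e) = inj₂ (r , e)
contract-root-hasRedex⁻¹ (mem m u) v h (mem-l r , e) =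
  Sum.map₁ (hasRedex-map mem-l (λ _ → refl)) (contract-root-hasRedex⁻¹ m v h (r , e))
contract-root-hasRedex⁻¹ (mem m u) v h (mem-r r , e) = inj₁ (mem-r r , e)

height-argument< : (A B : Ty Base) → height A < height (A ⇒ B)
height-argument< A B = s≤s (m≤m⊔n (height A) (height B))

-- Created redexes have a smaller degree than the contracted one.
contract-hasRedex⁻¹ : {t : Γ ⊢ A} (r : Redex t) → degree r ≤ d → HasRedex d (contract r) → HasRedex d t
contract-hasRedex⁻¹ (root {A = A} {B = B} {v = v} m) h q
  with contract-root-hasRedex⁻¹ m v (<-≤-trans (height-argument< A B) h) q
... | inj₁ q′ = hasRedex-map app-l (λ _ → refl) q′
... | inj₂ q′ = hasRedex-map app-r (λ _ → refl) q′
contract-hasRedex⁻¹ (in-ƛ r)  h (in-ƛ q , e)  = hasRedex-map in-ƛ (λ _ → refl) (contract-hasRedex⁻¹ r h (q , e))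
contract-hasRedex⁻¹ (app-l r) h (root m , e) with contractᴹ⁻¹ r m
... | inj₁ m′ = root m′ , e
... | inj₂ lt = ⊥-elim (<⇒≢ (<-≤-trans lt h) e)
contract-hasRedex⁻¹ (app-l r) h (app-l q , e) = hasRedex-map app-l (λ _ → refl) (contract-hasRedex⁻¹ r h (q , e))
contract-hasRedex⁻¹ (app-l r) h (app-r q , e) = app-r q , e
contract-hasRedex⁻¹ (app-r r) h (root m , e)  = root m , e
contract-hasRedex⁻¹ (app-r r) h (app-l q , e) = app-l q , e
contract-hasRedex⁻¹ (app-r r) h (app-r q , e) = hasRedex-map app-r (λ _ → refl) (contract-hasRedex⁻¹ r h (q , e))
contract-hasRedex⁻¹ (mem-l r) h (mem-l q , e) = hasRedex-map mem-l (λ _ → refl) (contract-hasRedex⁻¹ r h (q , e))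
contract-hasRedex⁻¹ (mem-l r) h (mem-r q , e) = mem-r q , e
contract-hasRedex⁻¹ (mem-r r) h (mem-l q , e) = mem-l q , e
contract-hasRedex⁻¹ (mem-r r) h (mem-r q , e) = hasRedex-map mem-r (λ _ → refl) (contract-hasRedex⁻¹ r h (q , e))

-- Residuals of the redexes of f and v in the contractum of f · v

contract-left : {f : Γ ⊢ A ⇒ B} (m : MAbs f) (v : Γ ⊢ A) → Redex f → Redex (contract (root {v = v} m))
contract-left (lam t)   v (in-ƛ r)  = mem-l (substituteᴿ (single v) r)
contract-left (mem m u) v (mem-l r) = mem-l (contract-left m v r)
contract-left (mem m u) v (mem-r r) = mem-r r

-- Of the many residuals of a redex of the argument, the one kept in memory.
contract-right : {f : Γ ⊢ A ⇒ B} (m : MAbs f) {v : Γ ⊢ A} → Redex v → Redex (contract (root {v = v} m))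
contract-right (lam t)   r = mem-r r
contract-right (mem m u) r = mem-l (contract-right m r)

contract-left-degree : {f : Γ ⊢ A ⇒ B} (m : MAbs f) (v : Γ ⊢ A) (r : Redex f) →
                       degree (contract-left m v r) ≡ degree r
contract-left-degree (lam t)   v (in-ƛ r)  = substituteᴿ-degree (single v) r
contract-left-degree (mem m u) v (mem-l r) = contract-left-degree m v r
contract-left-degree (mem m u) v (mem-r r) = refl

contract-right-degree : {f : Γ ⊢ A ⇒ B} (m : MAbs f) {v : Γ ⊢ A} (r : Redex v) →
                        degree (contract-right m r) ≡ degree r
contract-right-degree (lam t)   r = refl
contract-right-degree (mem m u) r = contract-right-degree m r

contract-left-injective : {f : Γ ⊢ A ⇒ B} (m : MAbs f) {v : Γ ⊢ A} (q r : Redex f) →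
                          contract-left m v q ≡ contract-left m v r → q ≡ r
contract-left-injective (lam t) {v} (in-ƛ q) (in-ƛ r) e =
  cong in-ƛ (substituteᴿ-injective (single v) q r (mem-l-injective e))
contract-left-injective (mem m u) (mem-l q) (mem-l r) e = cong mem-l (contract-left-injective m q r (mem-l-injective e))
contract-left-injective (mem m u) (mem-r q) (mem-r r) e = cong mem-r (mem-r-injective e)

contract-right-injective : {f : Γ ⊢ A ⇒ B} (m : MAbs f) {v : Γ ⊢ A} (q r : Redex v) →
                           contract-right m q ≡ contract-right m r → q ≡ r
contract-right-injective (lam t)   q r e = mem-r-injective e
contract-right-injective (mem m u) q r e = contract-right-injective m q r (mem-l-injective e)

contract-left≢right : {f : Γ ⊢ A ⇒ B} (m : MAbs f) {v : Γ ⊢ A} (q : Redex f) (r : Redex v) →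
                      contract-left m v q ≢ contract-right m r
contract-left≢right (lam t)   (in-ƛ q)  r ()
contract-left≢right (mem m u) (mem-l q) r e = contract-left≢right m q r (mem-l-injective e)
contract-left≢right (mem m u) (mem-r q) r ()

-- The root contraction does not duplicate the redexes of `f`, so the two orders of contraction
-- agree exactly.
contract-contract-left : {f : Γ ⊢ A ⇒ B} (m : MAbs f) (v : Γ ⊢ A) (r : Redex f) →
  contract (contract-left m v r) ≡ contract (root {v = v} (contractᴹ m r))
contract-contract-left (lam t)   v (in-ƛ r)  = cong (_❴ v ❵) (contract-substitute (single v) r)
contract-contract-left (mem m u) v (mem-l r) = cong (_❴ u ❵) (contract-contract-left m v r)
contract-contract-left (mem m u) v (mem-r r) = refl

-- Contracting the copy in memory leaves the copies substituted into the body; these are contracted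
-- afterwards, at the same degree.
contract-contract-right : {f : Γ ⊢ A ⇒ B} (m : MAbs f) {v : Γ ⊢ A} (r : Redex v) → degree r ≡ d →
  Reduction d (contract (contract-right m r)) (contract (root {v = contract r} m))
contract-contract-right (lam t)   r e = reduction-❴❵ (reduction-[]ʳ t (step r e done)) done
contract-contract-right (mem m u) r e = reduction-❴❵ (contract-contract-right m r e) done

-- Simplification at a degree

module Simplification (i : ℕ) where

  -- `app` receives the mode as an argument, so its lemmas go by cases on arbitrary modes and need
  -- not unfold the decisions made by `mode`.
  data Mode {Base : Set} {Γ : Ctx Base} {A B : Ty Base} (f : Γ ⊢ A ⇒ B) : Set where
    contracted : MAbs f → height (A ⇒ B) ≡ i → Mode f
    kept       : (MAbs f → height (A ⇒ B) ≢ i) → Mode f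

  mode : (f : Γ ⊢ A ⇒ B) → Mode f
  mode {A = A} {B = B} f with MAbs? f | height (A ⇒ B) ≟ i
  ... | yes m | yes e = contracted m e
  ... | yes m | no ¬e = kept (λ _ → ¬e)
  ... | no ¬m | _     = kept (λ m → ⊥-elim (¬m m))

  app : (f : Γ ⊢ A ⇒ B) (v : Γ ⊢ A) → Mode f → Γ ⊢ B
  app f v (contracted m _) = contract (root {v = v} m)
  app f v (kept _)         = f · v

  -- The simultaneous contraction of all redexes of degree i.
  simplify : Γ ⊢ A → Γ ⊢ A
  simplify (var x)   = var x
  simplify (ƛ t)     = ƛ simplify t
  simplify (t · u)   = app (simplify t) (simplify u) (mode (simplify t))
  simplify (t ❴ u ❵) = simplify t ❴ simplify u ❵

  app-contracted : {f : Γ ⊢ A ⇒ B} (v : Γ ⊢ A) (k : Mode f) (m : MAbs f) → height (A ⇒ B) ≡ i →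
                   app f v k ≡ contract (root {v = v} m)
  app-contracted v (contracted m′ _) m _ = cong (λ n → contract (root {v = v} n)) (MAbs-irrelevant m′ m)
  app-contracted v (kept ¬e)         m e = ⊥-elim (¬e m e)

  app-cong : {f f′ : Γ ⊢ A ⇒ B} {v v′ : Γ ⊢ A} → f ≡ f′ → v ≡ v′ → app f v (mode f) ≡ app f′ v′ (mode f′)
  app-cong refl refl = refl

  app-reduction : {f : Γ ⊢ A ⇒ B} (v : Γ ⊢ A) (k : Mode f) → Reduction i (f · v) (app f v k)
  app-reduction v (contracted m e) = step (root m) e done
  app-reduction v (kept _)         = done

  simplify-reduction : (t : Γ ⊢ A) → Reduction i t (simplify t)
  simplify-reduction (var x)   = done
  simplify-reduction (ƛ t)     = reduction-ƛ (simplify-reduction t)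
  simplify-reduction (t · u)   =
    reduction-· (simplify-reduction t) (simplify-reduction u) ⨾ app-reduction (simplify u) (mode (simplify t))
  simplify-reduction (t ❴ u ❵) = reduction-❴❵ (simplify-reduction t) (simplify-reduction u)

  simplifyᴹ : {u : Γ ⊢ A ⇒ B} → MAbs u → MAbs (simplify u)
  simplifyᴹ (lam t)   = lam (simplify t)
  simplifyᴹ (mem m r) = mem (simplifyᴹ m) (simplify r)

  -- The two modes agree: a contracted function stays an abstraction of the same type, and by
  -- inertness no kept one becomes an abstraction of height `i`.
  app-substitute : (σ : Sub Γ Δ) → Inert i σ → (f : Γ ⊢ A ⇒ B) (v : Γ ⊢ A) (k : Mode f) (k′ : Mode (substitute σ f)) →
                   app (substitute σ f) (substitute σ v) k′ ≡ substitute σ (app f v k)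
  app-substitute σ p f v (contracted m e) k′ =
    trans (app-contracted (substitute σ v) k′ (substituteᴹ σ m) e) (contract-root-substitute σ m v)
  app-substitute σ p f v (kept ¬e) (contracted m e) = ⊥-elim (¬e (substituteᴹ⁻¹ p f e m) e)
  app-substitute σ p f v (kept _)  (kept _)         = refl

  simplify-rename : (ξ : Ren Γ Δ) (t : Γ ⊢ A) → simplify (rename ξ t) ≡ rename ξ (simplify t)
  simplify-rename ξ (var x)   = refl
  simplify-rename ξ (ƛ t)     = cong ƛ_ (simplify-rename (extᴿ ξ) t)
  simplify-rename ξ (t · u)   =
    -- Renaming is treated as a substitution of variables, which is inert because no variable is an
    -- abstraction.
    trans (app-cong (trans (simplify-rename ξ t) (rename≡substitute ξ (simplify t)))
                    (trans (simplify-rename ξ u) (rename≡substitute ξ (simplify u))))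
    (trans (app-substitute (λ x → var (ξ x)) (λ _ _ ()) (simplify t) (simplify u) (mode _) (mode _))
           (sym (rename≡substitute ξ (simplify (t · u)))))
  simplify-rename ξ (t ❴ u ❵) = cong₂ _❴_❵ (simplify-rename ξ t) (simplify-rename ξ u)

  -- Inertness is asked of the simplified substitution `τ`, since modes are decided on simplified
  -- functions.
  simplify-substitute : (σ τ : Sub Γ Δ) → (∀ {B} (x : Γ ∋ B) → simplify (σ x) ≡ τ x) → Inert i τ →
                        (t : Γ ⊢ A) → simplify (substitute σ t) ≡ substitute τ (simplify t)
  simplify-substitute σ τ p q (var x)   = p x
  simplify-substitute σ τ p q (ƛ t)     = cong ƛ_ (simplify-substitute (exts σ) (exts τ)
    (λ { z → refl ; (s x) → trans (simplify-rename s (σ x)) (cong (rename s) (p x)) }) (exts-inert {σ = τ} q) t)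
  simplify-substitute σ τ p q (t · u)   =
    trans (app-cong (simplify-substitute σ τ p q t) (simplify-substitute σ τ p q u))
          (app-substitute τ q (simplify t) (simplify u) (mode _) (mode _))
  simplify-substitute σ τ p q (t ❴ u ❵) =
    cong₂ _❴_❵ (simplify-substitute σ τ p q t) (simplify-substitute σ τ p q u)

  -- `height A < i` makes the substitution of the argument inert. It holds for roots of degree `i`
  -- and for those of smaller degree; both cases are used below.
  simplify-contract-root : {f : Γ ⊢ A ⇒ B} (m : MAbs f) (v : Γ ⊢ A) → height A < i →
    contract (root {v = simplify v} (simplifyᴹ m)) ≡ simplify (contract (root {v = v} m))
  simplify-contract-root (lam t) v h = cong (_❴ simplify v ❵) (sym (simplify-substitute (single v) (single (simplify v))
    (λ { z → refl ; (s x) → refl }) (single-inert (simplify v) h) t))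
  simplify-contract-root (mem m u) v h = cong (_❴ simplify u ❵) (simplify-contract-root m v h)

  -- Contracting a redex of degree `i` only anticipates a contraction that `simplify` performs
  -- anyway.
  simplify-contract : {t : Γ ⊢ A} (r : Redex t) → degree r ≡ i → simplify (contract r) ≡ simplify t
  simplify-contract (root {A = A} {B = B} {v = v} m) e =
    trans (sym (simplify-contract-root m v (<-≤-trans (height-argument< A B) (≤-reflexive e))))
          (sym (app-contracted (simplify v) (mode _) (simplifyᴹ m) e))
  simplify-contract (in-ƛ r)          e = cong ƛ_ (simplify-contract r e)
  simplify-contract (app-l {v = v} r) e = app-cong {v = simplify v} (simplify-contract r e) refl
  simplify-contract (app-r {u = u} r) e = app-cong {f = simplify u} refl (simplify-contract r e)
  simplify-contract (mem-l {r = u} r) e = cong (_❴ simplify u ❵) (simplify-contract r e)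
  simplify-contract (mem-r {t = t} r) e = cong (simplify t ❴_❵) (simplify-contract r e)

  simplify-target : {t u : Γ ⊢ A} → Reduction i t u → simplify u ≡ simplify t
  simplify-target done         = refl
  simplify-target (step r e p) = trans (simplify-target p) (simplify-contract r e)

  app-root : {f : Γ ⊢ A ⇒ B} (v : Γ ⊢ A) (k : Mode f) → MAbs f → height (A ⇒ B) < i → Redex (app f v k)
  app-root v (contracted _ e) m h = ⊥-elim (<⇒≢ h e)
  app-root v (kept _)         m h = root m

  app-left : {f : Γ ⊢ A ⇒ B} (v : Γ ⊢ A) (k : Mode f) → Redex f → Redex (app f v k)
  app-left v (contracted m _) r = contract-left m v r
  app-left v (kept _)         r = app-l r

  app-right : {f : Γ ⊢ A ⇒ B} {v : Γ ⊢ A} (k : Mode f) → Redex v → Redex (app f v k)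
  app-right (contracted m _) r = contract-right m r
  app-right (kept _)         r = app-r r

  app-root-degree : {f : Γ ⊢ A ⇒ B} (v : Γ ⊢ A) (k : Mode f) (m : MAbs f) (h : height (A ⇒ B) < i) →
                    degree (app-root v k m h) ≡ height (A ⇒ B)
  app-root-degree v (contracted _ e) m h = ⊥-elim (<⇒≢ h e)
  app-root-degree v (kept _)         m h = refl

  app-left-degree : {f : Γ ⊢ A ⇒ B} (v : Γ ⊢ A) (k : Mode f) (r : Redex f) → degree (app-left v k r) ≡ degree r
  app-left-degree v (contracted m _) r = contract-left-degree m v r
  app-left-degree v (kept _)         r = refl

  app-right-degree : {f : Γ ⊢ A ⇒ B} {v : Γ ⊢ A} (k : Mode f) (r : Redex v) → degree (app-right k r) ≡ degree r
  app-right-degree (contracted m _) r = contract-right-degree m r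
  app-right-degree (kept _)         r = refl

  app-left-injective : {f : Γ ⊢ A ⇒ B} (v : Γ ⊢ A) (k : Mode f) (q r : Redex f) →
                       app-left v k q ≡ app-left v k r → q ≡ r
  app-left-injective v (contracted m _) q r p = contract-left-injective m q r p
  app-left-injective v (kept _)         q r p = app-l-injective p

  app-right-injective : {f : Γ ⊢ A ⇒ B} {v : Γ ⊢ A} (k : Mode f) (q r : Redex v) →
                        app-right k q ≡ app-right k r → q ≡ r
  app-right-injective (contracted m _) q r p = contract-right-injective m q r p
  app-right-injective (kept _)         q r p = app-r-injective p

  app-left≢right : {f : Γ ⊢ A ⇒ B} {v : Γ ⊢ A} (k : Mode f) (q : Redex f) (r : Redex v) →
                   app-left v k q ≢ app-right k r
  app-left≢right (contracted m _) q r p = contract-left≢right m q r p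
  app-left≢right (kept _)         q r ()

  app-root≢left : {f : Γ ⊢ A ⇒ B} (v : Γ ⊢ A) (k : Mode f) (m : MAbs f) (h : height (A ⇒ B) < i) (r : Redex f) →
                  app-root v k m h ≢ app-left v k r
  app-root≢left v (contracted _ e) m h r _ = <⇒≢ h e
  app-root≢left v (kept _)         m h r ()

  app-root≢right : {f : Γ ⊢ A ⇒ B} {v : Γ ⊢ A} (k : Mode f) (m : MAbs f) (h : height (A ⇒ B) < i) (r : Redex v) →
                   app-root v k m h ≢ app-right k r
  app-root≢right (contracted _ e) m h r _ = <⇒≢ h e
  app-root≢right (kept _)         m h r ()

  contract-app-root : {f : Γ ⊢ A ⇒ B} (v : Γ ⊢ A) (k : Mode f) (m : MAbs f) (h : height (A ⇒ B) < i) →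
                      contract (app-root v k m h) ≡ contract (root {v = v} m)
  contract-app-root v (contracted _ e) m h = ⊥-elim (<⇒≢ h e)
  contract-app-root v (kept _)         m h = refl

  -- A step of degree below `i` inside the function does not alter the mode: an abstraction remains
  -- one, and a newly created one has height below `i`.
  contract-app-left : {f : Γ ⊢ A ⇒ B} (v : Γ ⊢ A) (k : Mode f) (r : Redex f) → degree r < i →
                      (k′ : Mode (contract r)) → contract (app-left v k r) ≡ app (contract r) v k′
  contract-app-left v (contracted m e) r h k′ =
    trans (contract-contract-left m v r) (sym (app-contracted v k′ (contractᴹ m r) e))
  contract-app-left v (kept ¬e) r h (contracted m e) with contractᴹ⁻¹ r m
  ... | inj₁ m′ = ⊥-elim (¬e m′ e)
  ... | inj₂ lt = ⊥-elim (<⇒≢ (<-trans lt h) e)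
  contract-app-left v (kept _)  r h (kept _) = refl

  contract-app-right : {f : Γ ⊢ A ⇒ B} {v : Γ ⊢ A} (k : Mode f) (r : Redex v) → degree r ≡ d →
                       Reduction d (contract (app-right k r)) (app f (contract r) k)
  contract-app-right (contracted m _) r p = contract-contract-right m r p
  contract-app-right (kept _)         r p = done

  -- Where an application around the redex is contracted, `contract-left` or `contract-right`
  -- supplies the copy; the redex itself has degree below `i`, so its own root is kept.
  simplifyᴿ : {t : Γ ⊢ A} (r : Redex t) → degree r < i → Redex (simplify t)
  simplifyᴿ (root {v = v} m)          h = app-root (simplify v) (mode _) (simplifyᴹ m) h
  simplifyᴿ (in-ƛ r)                  h = in-ƛ (simplifyᴿ r h)
  simplifyᴿ (app-l {u = u} {v = v} r) h = app-left (simplify v) (mode (simplify u)) (simplifyᴿ r h)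
  simplifyᴿ (app-r {u = u} r)         h = app-right (mode (simplify u)) (simplifyᴿ r h)
  simplifyᴿ (mem-l r)                 h = mem-l (simplifyᴿ r h)
  simplifyᴿ (mem-r r)                 h = mem-r (simplifyᴿ r h)

  simplifyᴿ-degree : {t : Γ ⊢ A} (r : Redex t) (h : degree r < i) → degree (simplifyᴿ r h) ≡ degree r
  simplifyᴿ-degree (root {v = v} m)          h = app-root-degree (simplify v) (mode _) (simplifyᴹ m) h
  simplifyᴿ-degree (in-ƛ r)                  h = simplifyᴿ-degree r h
  simplifyᴿ-degree (app-l {u = u} {v = v} r) h =
    trans (app-left-degree (simplify v) (mode (simplify u)) (simplifyᴿ r h)) (simplifyᴿ-degree r h)
  simplifyᴿ-degree (app-r {u = u} r)         h =
    trans (app-right-degree (mode (simplify u)) (simplifyᴿ r h)) (simplifyᴿ-degree r h)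
  simplifyᴿ-degree (mem-l r)                 h = simplifyᴿ-degree r h
  simplifyᴿ-degree (mem-r r)                 h = simplifyᴿ-degree r h

  simplifyᴿ-injective : {t : Γ ⊢ A} (q r : Redex t) (h : degree q < i) (h′ : degree r < i) →
                        simplifyᴿ q h ≡ simplifyᴿ r h′ → q ≡ r
  simplifyᴿ-injective (root m)  (root n)  h h′ p = root-irrelevant m n
  simplifyᴿ-injective (in-ƛ q)  (in-ƛ r)  h h′ p = cong in-ƛ (simplifyᴿ-injective q r h h′ (in-ƛ-injective p))
  simplifyᴿ-injective (app-l {u = u} {v = v} q) (app-l r) h h′ p =
    cong app-l (simplifyᴿ-injective q r h h′ (app-left-injective (simplify v) (mode (simplify u)) _ _ p))
  simplifyᴿ-injective (app-r {u = u} q) (app-r r) h h′ p =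
    cong app-r (simplifyᴿ-injective q r h h′ (app-right-injective (mode (simplify u)) _ _ p))
  simplifyᴿ-injective (mem-l q) (mem-l r) h h′ p = cong mem-l (simplifyᴿ-injective q r h h′ (mem-l-injective p))
  simplifyᴿ-injective (mem-r q) (mem-r r) h h′ p = cong mem-r (simplifyᴿ-injective q r h h′ (mem-r-injective p))
  simplifyᴿ-injective (root {v = v} m) (app-l r) h h′ p =
    ⊥-elim (app-root≢left (simplify v) (mode _) (simplifyᴹ m) h (simplifyᴿ r h′) p)
  simplifyᴿ-injective (root m) (app-r r) h h′ p =
    ⊥-elim (app-root≢right (mode _) (simplifyᴹ m) h (simplifyᴿ r h′) p)
  simplifyᴿ-injective (app-l {v = v} q) (root m) h h′ p =
    ⊥-elim (app-root≢left (simplify v) (mode _) (simplifyᴹ m) h′ (simplifyᴿ q h) (sym p))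
  simplifyᴿ-injective (app-l q) (app-r r) h h′ p =
    ⊥-elim (app-left≢right (mode _) (simplifyᴿ q h) (simplifyᴿ r h′) p)
  simplifyᴿ-injective (app-r q) (root m) h h′ p =
    ⊥-elim (app-root≢right (mode _) (simplifyᴹ m) h′ (simplifyᴿ q h) (sym p))
  simplifyᴿ-injective (app-r q) (app-l r) h h′ p =
    ⊥-elim (app-left≢right (mode _) (simplifyᴿ r h′) (simplifyᴿ q h) (sym p))
  simplifyᴿ-injective (mem-l q) (mem-r r) h h′ ()
  simplifyᴿ-injective (mem-r q) (mem-l r) h h′ ()

  -- `simplify` may duplicate a redex that lies in an argument. After the chosen copy the others
  -- remain, and further steps of the same degree contract them.
  contract-simplifyᴿ : {t : Γ ⊢ A} (r : Redex t) (h : degree r < i) →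
                       Reduction (degree r) (contract (simplifyᴿ r h)) (simplify (contract r))
  contract-simplifyᴿ (root {A = A} {B = B} {v = v} m) h = ≡⇒reduction
    (trans (contract-app-root (simplify v) (mode _) (simplifyᴹ m) h)
           (simplify-contract-root m v (<-trans (height-argument< A B) h)))
  contract-simplifyᴿ (in-ƛ r) h = reduction-ƛ (contract-simplifyᴿ r h)
  contract-simplifyᴿ (app-l {u = u} {v = v} r) h =
    ≡⇒reduction (contract-app-left (simplify v) (mode (simplify u)) (simplifyᴿ r h)
                  (≤-<-trans (≤-reflexive (simplifyᴿ-degree r h)) h) (mode _)) ⨾
    -- The function changes along this reduction, so the mode is taken afresh at each of its terms;
    -- in the case of `app-r` it is fixed.
    reduction-map (λ f → app f (simplify v) (mode f)) (λ {f} → app-left (simplify v) (mode f))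
      (λ {f} → app-left-degree (simplify v) (mode f))
      (λ {f} q e → ≡⇒reduction (contract-app-left (simplify v) (mode f) q (≤-<-trans (≤-reflexive e) h) (mode _)))
      (contract-simplifyᴿ r h)
  contract-simplifyᴿ (app-r {u = u} r) h =
    contract-app-right k (simplifyᴿ r h) (simplifyᴿ-degree r h) ⨾
    reduction-map (λ v → app (simplify u) v k) (app-right k) (app-right-degree k) (contract-app-right k)
                  (contract-simplifyᴿ r h)
    where k = mode (simplify u)
  contract-simplifyᴿ (mem-l r) h = reduction-❴❵ (contract-simplifyᴿ r h) done
  contract-simplifyᴿ (mem-r r) h = reduction-❴❵ done (contract-simplifyᴿ r h)

-- Erasure of memories

infix 4 _⊵_

-- Memories are erased at any number of places at once: contraction copies the argument, and with it
-- the places of erasure.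
data _⊵_ {Base : Set} {Γ : Ctx Base} : {A : Ty Base} → Γ ⊢ A → Γ ⊢ A → Set where
  var   : (x : Γ ∋ A) → var x ⊵ var x
  ƛ_    : {t t′ : Γ ▸ A ⊢ B} → t ⊵ t′ → ƛ t ⊵ ƛ t′
  _·_   : {t t′ : Γ ⊢ A ⇒ B} {u u′ : Γ ⊢ A} → t ⊵ t′ → u ⊵ u′ → t · u ⊵ t′ · u′
  _❴_❵  : {t t′ : Γ ⊢ A} {u u′ : Γ ⊢ B} → t ⊵ t′ → u ⊵ u′ → t ❴ u ❵ ⊵ t′ ❴ u′ ❵
  erase : {t t′ : Γ ⊢ A} → t ⊵ t′ → (u : Γ ⊢ B) → t ❴ u ❵ ⊵ t′

⊵-refl : (t : Γ ⊢ A) → t ⊵ t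
⊵-refl (var x)   = var x
⊵-refl (ƛ t)     = ƛ ⊵-refl t
⊵-refl (t · u)   = ⊵-refl t · ⊵-refl u
⊵-refl (t ❴ u ❵) = ⊵-refl t ❴ ⊵-refl u ❵

⊵-rename : (ξ : Ren Γ Δ) {t t′ : Γ ⊢ A} → t ⊵ t′ → rename ξ t ⊵ rename ξ t′
⊵-rename ξ (var x)     = var (ξ x)
⊵-rename ξ (ƛ p)       = ƛ ⊵-rename (extᴿ ξ) p
⊵-rename ξ (p · q)     = ⊵-rename ξ p · ⊵-rename ξ q
⊵-rename ξ (p ❴ q ❵)   = ⊵-rename ξ p ❴ ⊵-rename ξ q ❵
⊵-rename ξ (erase p u) = erase (⊵-rename ξ p) (rename ξ u)

⊵-substitute : {σ τ : Sub Γ Δ} → (∀ {B} (x : Γ ∋ B) → σ x ⊵ τ x) →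
               {t t′ : Γ ⊢ A} → t ⊵ t′ → substitute σ t ⊵ substitute τ t′
⊵-substitute f (var x)     = f x
⊵-substitute f (ƛ p)       = ƛ ⊵-substitute (λ { z → var z ; (s x) → ⊵-rename s (f x) }) p
⊵-substitute f (p · q)     = ⊵-substitute f p · ⊵-substitute f q
⊵-substitute f (p ❴ q ❵)   = ⊵-substitute f p ❴ ⊵-substitute f q ❵
⊵-substitute {σ = σ} f (erase p u) = erase (⊵-substitute f p) (substitute σ u)

-- Memories erased between an abstraction and its argument belong to the `L` of `(ƛ t) ⟨ L ⟩`, so
-- restoring them does not block a redex.
unerasedᴹ : {f f′ : Γ ⊢ A ⇒ B} → f ⊵ f′ → MAbs f′ → MAbs f
unerasedᴹ (ƛ p)             (lam _)   = lam _
unerasedᴹ (_❴_❵ {u = u} p q) (mem m _) = mem (unerasedᴹ p m) u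
unerasedᴹ (erase p u)       m         = mem (unerasedᴹ p m) u

unerased : {t t′ : Γ ⊢ A} → t ⊵ t′ → Redex t′ → Redex t
unerased (erase p u) r         = mem-l (unerased p r)
unerased (ƛ p)       (in-ƛ r)  = in-ƛ (unerased p r)
unerased (p · q)     (root m)  = root (unerasedᴹ p m)
unerased (p · q)     (app-l r) = app-l (unerased p r)
unerased (p · q)     (app-r r) = app-r (unerased q r)
unerased (p ❴ q ❵)   (mem-l r) = mem-l (unerased p r)
unerased (p ❴ q ❵)   (mem-r r) = mem-r (unerased q r)

unerased-degree : {t t′ : Γ ⊢ A} (p : t ⊵ t′) (r : Redex t′) → degree (unerased p r) ≡ degree r
unerased-degree (erase p u) r         = unerased-degree p r
unerased-degree (ƛ p)       (in-ƛ r)  = unerased-degree p r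
unerased-degree (p · q)     (root m)  = refl
unerased-degree (p · q)     (app-l r) = unerased-degree p r
unerased-degree (p · q)     (app-r r) = unerased-degree q r
unerased-degree (p ❴ q ❵)   (mem-l r) = unerased-degree p r
unerased-degree (p ❴ q ❵)   (mem-r r) = unerased-degree q r

unerased-injective : {t t′ : Γ ⊢ A} (p : t ⊵ t′) (q r : Redex t′) → unerased p q ≡ unerased p r → q ≡ r
unerased-injective (erase p u) q r e = unerased-injective p q r (mem-l-injective e)
unerased-injective (ƛ p)     (in-ƛ q)  (in-ƛ r)  e = cong in-ƛ (unerased-injective p q r (in-ƛ-injective e))
unerased-injective (p · _)   (root m)  (root n)  e = root-irrelevant m n
unerased-injective (p · _)   (app-l q) (app-l r) e = cong app-l (unerased-injective p q r (app-l-injective e))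
unerased-injective (_ · p)   (app-r q) (app-r r) e = cong app-r (unerased-injective p q r (app-r-injective e))
unerased-injective (p ❴ _ ❵) (mem-l q) (mem-l r) e = cong mem-l (unerased-injective p q r (mem-l-injective e))
unerased-injective (_ ❴ p ❵) (mem-r q) (mem-r r) e = cong mem-r (unerased-injective p q r (mem-r-injective e))
unerased-injective (_ · _)   (root _)  (app-l _) ()
unerased-injective (_ · _)   (root _)  (app-r _) ()
unerased-injective (_ · _)   (app-l _) (root _)  ()
unerased-injective (_ · _)   (app-l _) (app-r _) ()
unerased-injective (_ · _)   (app-r _) (root _)  ()
unerased-injective (_ · _)   (app-r _) (app-l _) ()
unerased-injective (_ ❴ _ ❵) (mem-l _) (mem-r _) ()
unerased-injective (_ ❴ _ ❵) (mem-r _) (mem-l _) ()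

contract-root-⊵ : {f f′ : Γ ⊢ A ⇒ B} {v v′ : Γ ⊢ A} (p : f ⊵ f′) (m : MAbs f′) → v ⊵ v′ →
                  contract (root {v = v} (unerasedᴹ p m)) ⊵ contract (root {v = v′} m)
contract-root-⊵ (ƛ p)       (lam _)   q = ⊵-substitute (λ { z → q ; (s x) → var x }) p ❴ q ❵
contract-root-⊵ (p ❴ p′ ❵)  (mem m _) q = contract-root-⊵ p m q ❴ p′ ❵
contract-root-⊵ (erase p u) m         q = erase (contract-root-⊵ p m q) u

contract-unerased : {t t′ : Γ ⊢ A} (p : t ⊵ t′) (r : Redex t′) → contract (unerased p r) ⊵ contract r
contract-unerased (erase p u) r         = erase (contract-unerased p r) u
contract-unerased (ƛ p)       (in-ƛ r)  = ƛ contract-unerased p r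
contract-unerased (p · q)     (root m)  = contract-root-⊵ p m q
contract-unerased (p · q)     (app-l r) = contract-unerased p r · q
contract-unerased (p · q)     (app-r r) = p · contract-unerased q r
contract-unerased (p ❴ q ❵)   (mem-l r) = contract-unerased p r ❴ q ❵
contract-unerased (p ❴ q ❵)   (mem-r r) = p ❴ contract-unerased q r ❵

-- Simulation of β-reduction

⌈⌉-rename : (ξ : Ren Γ Δ) (M : Λ Γ A) → ⌈ β.rename ξ M ⌉ ≡ rename ξ ⌈ M ⌉
⌈⌉-rename ξ (var x) = refl
⌈⌉-rename ξ (ƛ M)   = cong ƛ_ (⌈⌉-rename (extᴿ ξ) M)
⌈⌉-rename ξ (M · N) = cong₂ _·_ (⌈⌉-rename ξ M) (⌈⌉-rename ξ N)

⌈⌉-substitute : (σ : β.Sub Γ Δ) (τ : Sub Γ Δ) → (∀ {B} (x : Γ ∋ B) → ⌈ σ x ⌉ ≡ τ x) →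
                (M : Λ Γ A) → ⌈ β.substitute σ M ⌉ ≡ substitute τ ⌈ M ⌉
⌈⌉-substitute σ τ p (var x) = p x
⌈⌉-substitute σ τ p (ƛ M)   = cong ƛ_ (⌈⌉-substitute (β.exts σ) (exts τ)
  (λ { z → refl ; (s x) → trans (⌈⌉-rename s (σ x)) (cong (rename s) (p x)) }) M)
⌈⌉-substitute σ τ p (M · N) = cong₂ _·_ (⌈⌉-substitute σ τ p M) (⌈⌉-substitute σ τ p N)

β-redex : {M N : Λ Γ A} → M ⟶β N → Redex ⌈ M ⌉
β-redex β       = root (lam _)
β-redex (ξ-ƛ p) = in-ƛ (β-redex p)
β-redex (ξ-l p) = app-l (β-redex p)
β-redex (ξ-r p) = app-r (β-redex p)

-- The step with memory differs from the β-step only in the copy of the argument that it stores.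
contract-β-redex : {M N : Λ Γ A} (p : M ⟶β N) → contract (β-redex p) ⊵ ⌈ N ⌉
contract-β-redex (β {M = M} {N = N}) =
  subst (⌈ M ⌉ [ ⌈ N ⌉ ] ❴ ⌈ N ⌉ ❵ ⊵_) (sym (⌈⌉-substitute (β.single N) (single ⌈ N ⌉) (λ { z → refl ; (s x) → refl }) M))
        (erase (⊵-refl (⌈ M ⌉ [ ⌈ N ⌉ ])) ⌈ N ⌉)
contract-β-redex (ξ-ƛ p)         = ƛ contract-β-redex p
contract-β-redex (ξ-l {N = N} p) = contract-β-redex p · ⊵-refl ⌈ N ⌉
contract-β-redex (ξ-r {M = M} p) = ⊵-refl ⌈ M ⌉ · contract-β-redex p

-- The orders on 𝕋 d and ℝ d

mutual
  -- The recursion through the two levels of lists is spelled out, with a starred version for each,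
  -- so that it is structural.
  ≈ᴱ-refl : (x : Entry d) → x ≈ᴱ x
  ≈ᴱ-refl (entry i p q b) = entry (Perm.refl (≈ᵀ-refl* b))

  ≈ᴱ-refl* : (xs : 𝕋 d) → Pointwise _≈ᴱ_ xs xs
  ≈ᴱ-refl* []       = []
  ≈ᴱ-refl* (x ∷ xs) = ≈ᴱ-refl x ∷ ≈ᴱ-refl* xs

  ≈ᵀ-refl* : (b : List (𝕋 d)) → Pointwise _≈ᵀ_ b b
  ≈ᵀ-refl* []       = []
  ≈ᵀ-refl* (x ∷ xs) = Perm.refl (≈ᴱ-refl* x) ∷ ≈ᵀ-refl* xs

mutual
  ≈ᴱ-sym : Symmetric (_≈ᴱ_ {d})
  ≈ᴱ-sym (entry p) = entry (≈ᴿ-sym p)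

  ≈ᵀ-sym : Symmetric (_≈ᵀ_ {d})
  ≈ᵀ-sym (Perm.refl p)     = Perm.refl (≈ᴱ-sym* p)
  ≈ᵀ-sym (Perm.prep e p)   = Perm.prep (≈ᴱ-sym e) (≈ᵀ-sym p)
  ≈ᵀ-sym (Perm.swap e f p) = Perm.swap (≈ᴱ-sym f) (≈ᴱ-sym e) (≈ᵀ-sym p)
  ≈ᵀ-sym (Perm.trans p q)  = Perm.trans (≈ᵀ-sym q) (≈ᵀ-sym p)

  ≈ᴱ-sym* : Symmetric (Pointwise (_≈ᴱ_ {d}))
  ≈ᴱ-sym* []       = []
  ≈ᴱ-sym* (e ∷ es) = ≈ᴱ-sym e ∷ ≈ᴱ-sym* es

  ≈ᴿ-sym : Symmetric (Permutation (_≈ᵀ_ {d}))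
  ≈ᴿ-sym (Perm.refl p)     = Perm.refl (≈ᵀ-sym* p)
  ≈ᴿ-sym (Perm.prep e p)   = Perm.prep (≈ᵀ-sym e) (≈ᴿ-sym p)
  ≈ᴿ-sym (Perm.swap e f p) = Perm.swap (≈ᵀ-sym f) (≈ᵀ-sym e) (≈ᴿ-sym p)
  ≈ᴿ-sym (Perm.trans p q)  = Perm.trans (≈ᴿ-sym q) (≈ᴿ-sym p)

  ≈ᵀ-sym* : Symmetric (Pointwise (_≈ᵀ_ {d}))
  ≈ᵀ-sym* []       = []
  ≈ᵀ-sym* (e ∷ es) = ≈ᵀ-sym e ∷ ≈ᵀ-sym* es

module OnEntries {d : ℕ} = Multiset (_≈ᴱ_ {d}) _>ᴱ_ (λ {x} → ≈ᴱ-refl x) ≈ᴱ-sym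
open OnEntries using () renaming (_⪰_ to _⪰ᵀ_; _≽_ to _≽ᴱ_; _≽?_ to _≽ᴱ?_; absent to absentᴱ; present to presentᴱ)

module On𝕋 {d : ℕ} = Multiset (_≈ᵀ_ {d}) _≻ᵀ_ OnEntries.≋-refl ≈ᵀ-sym
open On𝕋 using () renaming (_⪰_ to _⪰ᴿ_; _≻ᴹ_ to _≻ᴿ_)

module ImageOnEntries {d : ℕ} = Image (_≈ᴱ_ {d}) _>ᴱ_ (λ {x} → ≈ᴱ-refl x) ≈ᴱ-sym
module ImageOn𝕋 {d : ℕ} = Image (_≈ᵀ_ {d}) _≻ᵀ_ OnEntries.≋-refl ≈ᵀ-sym

entry-≽ : ∀ {i p q p′ q′ b b′} → b ⪰ᴿ b′ → entry {d} i p q b ≽ᴱ entry i p′ q′ b′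
entry-≽ (inj₁ p) = inj₁ (right p)
entry-≽ (inj₂ p) = inj₂ (entry p)

𝒯-entry-≽ : ∀ D {t u : Γ ⊢ A} (r : Redex t) (q : Redex u) → degree q ≡ degree r →
            (degree r ≤ D → ℛ (degree r) u ⪰ᴿ ℛ (degree r) t) → 𝒯-entry D u q ≽ᴱ? 𝒯-entry D t r
𝒯-entry-≽ D {t} {u} r q e p with degree r ≤? D | degree q ≤? D
... | no _  | _      = absentᴱ
... | yes h | no ¬h′ = ⊥-elim (¬h′ (≤-trans (≤-reflexive e) h))
... | yes h | yes h′ = presentᴱ (cast (degree≥1 q) h′ e)
  where
  -- `degree q` is generalised to a variable `i`, so that its equation with `degree r` can be
  -- matched on.
  cast : ∀ {i} (l : 1 ≤ i) (h′ : i ≤ D) → i ≡ degree r →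
         entry i l h′ (ℛ i u) ≽ᴱ entry (degree r) (degree≥1 r) h (ℛ (degree r) t)
  cast l h′ refl = entry-≽ (p h)

-- Simulations

-- The bound `k` accommodates simplification at `k`, which contracts the redexes of that degree. The
-- reduction in `copy-contract` accommodates redexes with several copies in `u`.
record Simulation {Base : Set} {Γ : Ctx Base} {A : Ty Base} (k : ℕ) (_≲_ : Rel (Γ ⊢ A) 0ℓ) : Set where
  field
    copy           : ∀ {t u} → t ≲ u → (r : Redex t) → degree r < k → Redex u
    copy-degree    : ∀ {t u} (p : t ≲ u) (r : Redex t) (h : degree r < k) → degree (copy p r h) ≡ degree r
    copy-injective : ∀ {t u} (p : t ≲ u) (q r : Redex t) (h : degree q < k) (h′ : degree r < k) →
                     copy p q h ≡ copy p r h′ → q ≡ r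
    copy-contract  : ∀ {t u} (p : t ≲ u) (r : Redex t) (h : degree r < k) →
                     ∃ λ w → Reduction (degree r) (contract (copy p r h)) w × contract r ≲ w

done≢step : {t u : Γ ⊢ A} {r : Redex t} {e : degree r ≡ d} {ρ : Reduction d (contract r) u} →
            _≢_ {A = ReductionFrom d t} (t , done) (u , step r e ρ)
done≢step ()

step-redex : {t u v : Γ ⊢ A} {q r : Redex t} {e : degree q ≡ d} {e′ : degree r ≡ d}
             {ρ : Reduction d (contract q) u} {ρ′ : Reduction d (contract r) v} →
             _≡_ {A = ReductionFrom d t} (u , step q e ρ) (v , step r e′ ρ′) → q ≡ r
step-redex refl = refl

step-injective : {t u v : Γ ⊢ A} {r : Redex t} {e e′ : degree r ≡ d}
                 {ρ : Reduction d (contract r) u} {ρ′ : Reduction d (contract r) v} →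
                 _≡_ {A = ReductionFrom d t} (u , step r e ρ) (v , step r e′ ρ′) →
                 _≡_ {A = ReductionFrom d (contract r)} (u , ρ) (v , ρ′)
step-injective refl = refl

⨾-injective : {t u v w : Γ ⊢ A} (π : Reduction d t u) {ρ : Reduction d u v} {ρ′ : Reduction d u w} →
              _≡_ {A = ReductionFrom d t} (v , π ⨾ ρ) (w , π ⨾ ρ′) →
              _≡_ {A = ReductionFrom d u} (v , ρ) (w , ρ′)
⨾-injective done         e = e
⨾-injective (step r _ π) e = ⨾-injective π (step-injective e)

module _ {Base : Set} {Γ : Ctx Base} {A : Ty Base} {k : ℕ} {_≲_ : Rel (Γ ⊢ A) 0ℓ} (S : Simulation k _≲_) where
  open Simulation S

  private
    below : ∀ {t : Γ ⊢ A} (r : Redex t) → degree r ≡ d → d < k → degree r < k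
    below r e h = ≤-<-trans (≤-reflexive e) h

    complete-copy : ∀ {t u} (p : t ≲ u) (r : Redex t) (h : degree r < k) → degree r ≡ d →
                    ∃ λ w → Reduction d (contract (copy p r h)) w × contract r ≲ w
    complete-copy p r h refl = copy-contract p r h

  simulate : ∀ {t u t′} → d < k → t ≲ u → Reduction d t t′ → ∃ λ u′ → t′ ≲ u′ × Reduction d u u′
  simulate h p done         = _ , p , done
  simulate h p (step r e ρ) =
    let l            = below r e h
        w , π , q    = complete-copy p r l e
        u′ , q′ , ρ′ = simulate h q ρ
    in  u′ , q′ , step (copy p r l) (trans (copy-degree p r l) e) (π ⨾ ρ′)

  simulateᶠ : ∀ {t u t′} → d < k → t ≲ u → Reduction d t t′ → ReductionFrom d u
  simulateᶠ h p ρ = let u′ , _ , ρ′ = simulate h p ρ in u′ , ρ′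

  -- The image of a nonempty reduction begins with the copy of its first redex, so equal images have
  -- the same first redex. The completing reduction that follows is then the same and can be
  -- cancelled.
  simulateᶠ-injective : ∀ {t u t₁ t₂} (h : d < k) (p : t ≲ u) (ρ₁ : Reduction d t t₁) (ρ₂ : Reduction d t t₂) →
                        simulateᶠ h p ρ₁ ≡ simulateᶠ h p ρ₂ → _≡_ {A = ReductionFrom d t} (t₁ , ρ₁) (t₂ , ρ₂)
  simulateᶠ-injective h p done           done           _  = refl
  simulateᶠ-injective h p done           (step _ _ _)   eq = ⊥-elim (done≢step eq)
  simulateᶠ-injective h p (step _ _ _)   done           eq = ⊥-elim (done≢step (sym eq))
  simulateᶠ-injective h p (step q e ρ₁) (step r e′ ρ₂) eq
    with copy-injective p q r (below q e h) (below r e′ h) (step-redex eq)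
  -- The completing reductions are computed from `e` and `e′`; they coincide once these proofs are
  -- identified.
  ... | refl with ≡-irrelevant e e′
  ... | refl = cong (λ { (v , σ) → v , step q e σ })
                    (simulateᶠ-injective h (proj₂ (proj₂ completed)) ρ₁ ρ₂
                      (⨾-injective (proj₁ (proj₂ completed)) (step-injective eq)))
    where completed = complete-copy p q (below q e h) e

  private
    copy? : ∀ {t u} → t ≲ u → Redex t → Maybe (Redex u)
    copy? p r with degree r <? k
    ... | yes h = just (copy p r h)
    ... | no _  = nothing

    copy?-injective : ∀ {t u} (p : t ≲ u) → PartialInjective (copy? p)
    copy?-injective p {q} {r} e e′ with degree q <? k | degree r <? k
    copy?-injective p {q} {r} refl e′ | yes h | yes h′ = copy-injective p q r h h′ (sym (just-injective e′))

  -- Two nested injections: copies match redexes of equal degree, and simulated reductions match the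
  -- elements of `ℛ`. Their targets are again related and are measured at a smaller level, where
  -- induction applies.
  simulation-𝒯 : ∀ D → Acc _<_ D → D < k → ∀ {t u} → t ≲ u → 𝒯≤ D u ⪰ᵀ 𝒯≤ D t
  simulation-𝒯 D (acc rs) h {t} {u} p = subst₂ _⪰ᵀ_ (sym (𝒯≤-unfold D u)) (sym (𝒯≤-unfold D t))
    (ImageOnEntries.mapMaybe-image (redex-enumeration t) (redex-enumeration u)
                                   (copy? p) (copy?-injective p) entry-copied)
    where
    ℛ-copied : 1 ≤ d → d ≤ D → ℛ d u ⪰ᴿ ℛ d t
    -- With the degree written as `suc d`, targets are measured at level `d`, and `suc d ≤ D` is the
    -- required descent.
    ℛ-copied {suc d} _ d≤D =
      ImageOn𝕋.map-image (reduction-enumeration (suc d) t) (reduction-enumeration (suc d) u)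
        (λ (_ , ρ) → simulateᶠ (≤-<-trans d≤D h) p ρ)
        (λ {(_ , ρ₁)} {(_ , ρ₂)} → simulateᶠ-injective (≤-<-trans d≤D h) p ρ₁ ρ₂)
        (λ { (_ , ρ) → simulation-𝒯 d (rs d≤D) (<-≤-trans (n<1+n d) (≤-trans d≤D (<⇒≤ h)))
                                    (proj₁ (proj₂ (simulate (≤-<-trans d≤D h) p ρ))) })

    entry-copied : ∀ r → (copy? p r >>= 𝒯-entry D u) ≽ᴱ? 𝒯-entry D t r
    entry-copied r with degree r <? k
    ... | yes l = 𝒯-entry-≽ D r (copy p r l) (copy-degree p r l) (ℛ-copied (degree≥1 r))
    -- A redex without a copy has degree at least `k`, hence above `D`, and contributes no entry.
    ... | no ¬l with degree r ≤? D
    ...   | yes l = ⊥-elim (¬l (≤-<-trans l h))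
    ...   | no _  = absentᴱ

-- The two simulations and their effect on the measure

erasure-simulation : ∀ k → Simulation {Γ = Γ} {A} k (λ t u → u ⊵ t)
erasure-simulation k = record
  { copy           = λ p r _ → unerased p r
  ; copy-degree    = λ p r _ → unerased-degree p r
  ; copy-injective = λ p q r _ _ → unerased-injective p q r
  ; copy-contract  = λ p r _ → _ , done , contract-unerased p r
  }

open Simplification using (simplify; simplifyᴿ; simplifyᴿ-degree; simplifyᴿ-injective; contract-simplifyᴿ; simplify-reduction; simplify-target)

simplification-simulation : ∀ k → Simulation {Γ = Γ} {A} k (λ t u → u ≡ simplify k t)
simplification-simulation k = record
  { copy           = λ { refl r h → simplifyᴿ k r h }
  ; copy-degree    = λ { refl r h → simplifyᴿ-degree k r h }
  ; copy-injective = λ { refl q r h h′ → simplifyᴿ-injective k q r h h′ }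
  ; copy-contract  = λ { refl r h → _ , contract-simplifyᴿ k r h , refl }
  }

𝒯-⊵ : ∀ D {t u : Γ ⊢ A} → t ⊵ u → 𝒯≤ D t ⪰ᵀ 𝒯≤ D u
𝒯-⊵ D p = simulation-𝒯 (erasure-simulation (suc D)) D (<-wellFounded D) (n<1+n D) p

𝒯-simplify : ∀ D (t : Γ ⊢ A) → 𝒯≤ D (simplify (suc D) t) ⪰ᵀ 𝒯≤ D t
𝒯-simplify D t = simulation-𝒯 (simplification-simulation (suc D)) D (<-wellFounded D) (n<1+n D) {t} refl

-- Strict decrease

𝒯-entry-present : ∀ D {t : Γ ⊢ A} (r : Redex t) (h : degree r ≤ D) →
                  𝒯-entry D t r ≡ just (entry (degree r) (degree≥1 r) h (ℛ (degree r) t))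
𝒯-entry-present D r h with degree r ≤? D
... | yes h′ = cong (λ l → just (entry _ _ l _)) (≤-irrelevant h′ h)
... | no ¬h  = ⊥-elim (¬h h)

∈-𝒯 : ∀ D {t : Γ ⊢ A} (r : Redex t) (h : degree r ≤ D) →
      entry (degree r) (degree≥1 r) h (ℛ (degree r) t) ∈ mapMaybe (𝒯-entry D t) (redexes t)
∈-𝒯 D {t} r h = Any.mapMaybe⁺ (𝒯-entry D t) (redexes t)
  (Any.map (λ { refl → Maybe.just refl })
           (subst (_∈ map (𝒯-entry D t) (redexes t)) (𝒯-entry-present D r h)
                  (∈-map⁺ (𝒯-entry D t) (complete (redex-enumeration t) r))))

-- The parameter is the induction hypothesis at level `D`; it serves to compare values of `ℛ` at
-- degree `suc D`.
module _ {D : ℕ} (𝒯-contract : ∀ {Base} {Γ : Ctx Base} {A} {t : Γ ⊢ A} (r : Redex t) → degree r ≤ D →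
                               𝒯≤ D t ≻ᵀ 𝒯≤ D (contract r)) where

  𝒯-reduction : {t u : Γ ⊢ A} → d ≤ D → Reduction d t u → 𝒯≤ D t ⪰ᵀ 𝒯≤ D u
  𝒯-reduction h done            = inj₂ OnEntries.≋-refl
  𝒯-reduction h (step r refl ρ) = inj₁ (OnEntries.≻-⪰-trans (𝒯-contract r h) (𝒯-reduction h ρ))

  -- A single element of `ℛ (suc D) t`, the value at the simplification of `t`, dominates all
  -- elements of the other side, however many there are.
  ℛ-contract< : {t : Γ ⊢ A} (r : Redex t) → degree r ≤ D → ℛ (suc D) t ≻ᴿ ℛ (suc D) (contract r)
  ℛ-contract< {t = t} r h = On𝕋.dominated t↓∈ (All.map⁺ (All.universal below (reductions (suc D) (contract r))))
    where
    r↓ : Redex (simplify (suc D) t)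
    r↓ = simplifyᴿ (suc D) r (s≤s h)

    t↓∈ : 𝒯≤ D (simplify (suc D) t) ∈ ℛ (suc D) t
    t↓∈ = ∈-map⁺ (λ ρ → 𝒯≤ D (proj₁ ρ)) (complete (reduction-enumeration (suc D) t) (_ , simplify-reduction (suc D) t))

    t↓≻ : 𝒯≤ D (simplify (suc D) t) ≻ᵀ 𝒯≤ D (simplify (suc D) (contract r))
    t↓≻ = OnEntries.≻-⪰-trans (𝒯-contract r↓ (≤-trans (≤-reflexive (simplifyᴿ-degree (suc D) r (s≤s h))) h))
                              (𝒯-reduction h (contract-simplifyᴿ (suc D) r (s≤s h)))

    below : ∀ (ρ : ReductionFrom (suc D) (contract r)) → Any (_≻ᵀ 𝒯≤ D (proj₁ ρ)) (ℛ (suc D) t)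
    below (u , ρ) = lose t↓∈ (OnEntries.≻-⪰-trans t↓≻
      (subst (λ w → 𝒯≤ D w ⪰ᵀ 𝒯≤ D u) (simplify-target (suc D) ρ) (𝒯-simplify D u)))

-- Prefixing the step `r` is injective and preserves targets; the empty reduction of `t` is not of
-- this form and gives strictness.
ℛ-contract≡ : {t : Γ ⊢ A} (r : Redex t) → ℛ (degree r) t ≻ᴿ ℛ (degree r) (contract r)
ℛ-contract≡ {t = t} r =
  ImageOn𝕋.map-image-strict (reduction-enumeration (degree r) (contract r)) (reduction-enumeration (degree r) t)
    (λ (u , ρ) → u , step r refl ρ) step-injective (λ _ → inj₂ OnEntries.≋-refl)
    ((t , done) , λ _ e → done≢step (sym e))

-- Redexes may be duplicated by the step, so no injection is sought: each entry of `contract r` is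
-- strictly below some entry of `t`, and many may lie below the same one.
𝒯-contract : ∀ D → Acc _<_ D → {t : Γ ⊢ A} (r : Redex t) → degree r ≤ D → 𝒯≤ D t ≻ᵀ 𝒯≤ D (contract r)
𝒯-contract D (acc rs) {t} r h = subst₂ _≻ᵀ_ (sym (𝒯≤-unfold D t)) (sym (𝒯≤-unfold D (contract r)))
  (OnEntries.dominated (∈-𝒯 D r h) (All.mapMaybe⁺ (All.map⁺ (All.universal entry-below (redexes (contract r))))))
  where
  ℛ-below : degree r ≤ d → d ≤ D → ℛ d t ≻ᴿ ℛ d (contract r)
  ℛ-below l l′ with m≤n⇒m<n∨m≡n l
  ... | inj₂ refl      = ℛ-contract≡ r
  -- Here `d` is a successor, and its predecessor is below `D`, so the induction hypothesis is
  -- available at that level.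
  ... | inj₁ (s≤s l<d) = ℛ-contract< (λ q → 𝒯-contract _ (rs l′) q) r l<d

  entry-below : ∀ q → Maybe.All (λ y → Any (_>ᴱ y) (mapMaybe (𝒯-entry D t) (redexes t))) (𝒯-entry D (contract r) q)
  entry-below q with degree q ≤? D
  ... | no _  = Maybe.nothing
  ... | yes l with degree r ≤? degree q
  ...   | no r≰q = Maybe.just (lose (∈-𝒯 D r h) (left (≰⇒> r≰q)))
  ...   | yes r≤q with contract-hasRedex⁻¹ r r≤q (q , refl)
  ...     | q′ , e = Maybe.just (lose (∈-𝒯 D q′ (≤-trans (≤-reflexive e) l)) (above e))
    where
    -- The degree of `q′` is generalised to `i`, so that its equation with `degree q` can be matched
    -- on.
    above : ∀ {i l′ l″} → i ≡ degree q →
            entry i l′ l″ (ℛ i t) >ᴱ entry (degree q) (degree≥1 q) l (ℛ (degree q) (contract r))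
    above refl = right (ℛ-below r≤q l)

-- Comparison at a common degree bound

degree≤maxdeg : {t : Γ ⊢ A} (r : Redex t) → degree r ≤ maxdeg t
degree≤maxdeg {t = t} r = bound (complete (redex-enumeration t) r)
  where
  bound : ∀ {rs} → r ∈ rs → degree r ≤ foldr _⊔_ 0 (map degree rs)
  bound (here refl)        = m≤m⊔n (degree r) _
  bound {q ∷ rs} (there i) = ≤-trans (bound i) (m≤n⊔m (degree q) _)

-- All redexes of `t` are already counted at `maxdeg t`; raising the bound changes only the proofs
-- that degrees are within it.
include-𝒯 : ∀ {D} (t : Γ ⊢ A) (h : maxdeg t ≤ D) → include h (𝒯≤ (maxdeg t) t) ≡ 𝒯≤ D t
include-𝒯 {D = D} t h = trans (cong (include h) (𝒯≤-unfold (maxdeg t) t))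
                        (trans (included (redexes t)) (sym (𝒯≤-unfold D t)))
  where
  included : ∀ rs → include h (mapMaybe (𝒯-entry (maxdeg t) t) rs) ≡ mapMaybe (𝒯-entry D t) rs
  included []       = refl
  included (r ∷ rs) rewrite 𝒯-entry-present (maxdeg t) r (degree≤maxdeg r)
                          | 𝒯-entry-present D r (≤-trans (degree≤maxdeg r) h) = cong (_ ∷_) (included rs)

theorem32 : {Base : Set} {Γ : Ctx Base} {A : Ty Base} {M N : Λ Γ A} → M ⟶β N → 𝒯ᵐ M ≻ 𝒯ᵐ N
theorem32 {M = M} {N} p =
  subst₂ _≻ᵀ_ (sym (include-𝒯 ⌈ M ⌉ (m≤m⊔n _ _))) (sym (include-𝒯 ⌈ N ⌉ (m≤n⊔m (maxdeg ⌈ M ⌉) _)))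
    -- At the common bound the contraction with memory decreases the measure strictly, and the
    -- erasure that leads to `⌈ N ⌉` does not increase it.
    (OnEntries.≻-⪰-trans
      (𝒯-contract D (<-wellFounded D) (β-redex p) (≤-trans (degree≤maxdeg (β-redex p)) (m≤m⊔n _ _)))
      (𝒯-⊵ D (contract-β-redex p)))
  where D = maxdeg ⌈ M ⌉ ⊔ maxdeg ⌈ N ⌉
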